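{- Let $t\geq 2$ be an integer. Every $PG(t-1,2)$-free matroid $M$ with $|M|>(1-3\cdot 2^{ -t})2^{r(M)}$ satisfies $\chi(M)\in\{t-1,t\}$.
   Context: A matroid $M$ means a simple binary matroid, represented by an integer $r(M)\geq 0$ (its rank) and a set $E(M)\subseteq \mathbb{F}_2^{r(M)}\setminus\{0\}$ that spans $\mathbb{F}_2^{r(M)}$; $|M|:=|E(M)|$. The critical number $\chi(M)$ is the smallest $k$ such that some subspace of $\mathbb{F}_2^{r(M)}$ of codimension $k$ is disjoint from $E(M)$. A matroid $M$ contains a matroid $N$ if there is an injective linear map $\iota:\mathbb{F}_2^{r(N)}\to\mathbb{F}_2^{r(M)}$ with $\iota(E(N))\subseteq E(M)$; $M$ is $N$-free if it does not contain $N$. The projective geometry $PG(t-1,2)$ is the matroid of rank $t$ with edge set $\mathbb{F}_2^t\setminus\{0\}$. -}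

module Defs where

open import Data.Bool using (Bool; true; false; _xor_; _∧_; T; not)
open import Data.Nat using (ℕ; zero; suc; _<_)
open import Data.Vec using (Vec; []; _∷_; replicate; zipWith; foldr; map)
open import Data.List using (List; length; filter; cartesianProductWith; [_]; _++_) renaming ([] to []ˡ; _∷_ to _∷ˡ_; foldr to foldrˡ; map to mapˡ)
open import Data.List.Relation.Unary.All using (All)
open import Data.Product using (Σ; ∃; _×_; _,_)
open import Data.Sum using (_⊎_)
open import Relation.Nullary using (¬_)
open import Relation.Binary.PropositionalEquality using (_≡_; _≢_; refl)
open import Function.Definitions using (Injective)

F₂^ : ℕ → Set
F₂^ r = Vec Bool r

𝟎 : ∀ {r} → F₂^ r
𝟎 = replicate _ false

_⊕_ : ∀ {r} → F₂^ r → F₂^ r → F₂^ r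
_⊕_ = zipWith _xor_

vsum : ∀ {r} → List (F₂^ r) → F₂^ r
vsum = foldrˡ _⊕_ 𝟎

allVecs : (r : ℕ) → List (F₂^ r)
allVecs zero = [ [] ]
allVecs (suc r) = mapˡ (false ∷_) (allVecs r) ++ mapˡ (true ∷_) (allVecs r)

count : ∀ {r} → (F₂^ r → Bool) → ℕ
count {r} P = length (filter (λ v → Data.Bool._≟_ (P v) true) (allVecs r))
  where import Data.Bool

-- A simple binary matroid: rank r and edge set E ⊆ F₂^r ∖ {0}
-- (given by its characteristic function) spanning F₂^r.
record Matroid : Set where
  field
    rank     : ℕ
    E        : F₂^ rank → Bool
    nonzero  : ∀ v → T (E v) → v ≢ 𝟎
    spanning : ∀ v → Σ (List (F₂^ rank)) λ xs → All (λ x → T (E x)) xs × vsum xs ≡ v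
open Matroid public

size : Matroid → ℕ
size M = count (E M)

-- Matrices: a linear map F₂^n → F₂^m is given by its n columns in F₂^m.
Matrix : ℕ → ℕ → Set
Matrix m n = Vec (F₂^ m) n

apply : ∀ {m n} → Matrix m n → F₂^ n → F₂^ m
apply [] [] = 𝟎
apply (c ∷ cs) (false ∷ x) = apply cs x
apply (c ∷ cs) (true ∷ x) = c ⊕ apply cs x

Surjective : ∀ {m n} → Matrix m n → Set
Surjective {m} A = ∀ (y : F₂^ m) → ∃ λ x → apply A x ≡ y

-- Some subspace of F₂^{r(M)} of codimension k is disjoint from E(M).
-- Codimension-k subspaces are exactly kernels of surjective linear maps
-- F₂^{r(M)} → F₂^k.
HasDisjointCodim : Matroid → ℕ → Set
HasDisjointCodim M k =
  Σ (Matrix k (rank M)) λ A → Surjective A × (∀ v → T (E M v) → apply A v ≢ 𝟎)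

CriticalNumberIs : Matroid → ℕ → Set
CriticalNumberIs M k = HasDisjointCodim M k × (∀ j → j < k → ¬ HasDisjointCodim M j)

Contains : Matroid → Matroid → Set
Contains M N =
  Σ (Matrix (rank M) (rank N)) λ ι →
    Injective _≡_ _≡_ (apply ι) × (∀ v → T (E N v) → T (E M (apply ι v)))

isZero : ∀ {r} → F₂^ r → Bool
isZero [] = true
isZero (true ∷ v) = false
isZero (false ∷ v) = isZero v

private
  isZero-sound : ∀ {r} (v : F₂^ r) → T (isZero v) → v ≡ 𝟎
  isZero-sound [] _ = refl
  isZero-sound (false ∷ v) p with isZero-sound v p
  ... | refl = refl

  isZero-complete : ∀ {r} (v : F₂^ r) → v ≡ 𝟎 → T (isZero v)
  isZero-complete [] _ = _
  isZero-complete (false ∷ v) refl = isZero-complete v refl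

  pg-nonzero : ∀ {t} (v : F₂^ t) → T (not (isZero v)) → v ≢ 𝟎
  pg-nonzero v p eq with isZero v | isZero-complete v eq
  pg-nonzero v () eq | true | _

  ⊕-𝟎 : ∀ {r} (v : F₂^ r) → v ⊕ 𝟎 ≡ v
  ⊕-𝟎 [] = refl
  ⊕-𝟎 (false ∷ v) rewrite ⊕-𝟎 v = refl
  ⊕-𝟎 (true ∷ v) rewrite ⊕-𝟎 v = refl

  pg-span : ∀ {t} (v : F₂^ t) → Σ (List (F₂^ t)) λ xs → All (λ x → T (not (isZero x))) xs × vsum xs ≡ v
  pg-span v with isZero v in eq
  ... | true  = []ˡ , All.[] , sym′ (isZero-sound v (subst′ eq))
    where
      sym′ : ∀ {a b : F₂^ _} → a ≡ b → b ≡ a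
      sym′ refl = refl
      subst′ : isZero v ≡ true → T (isZero v)
      subst′ e rewrite e = _
  ... | false = [ v ] , (subst″ eq All.∷ All.[]) , ⊕-𝟎 v
    where
      subst″ : isZero v ≡ false → T (not (isZero v))
      subst″ e rewrite e = _

-- The projective geometry PG(t-1,2): rank t, E = F₂^t ∖ {0}.
PG : ℕ → Matroid
PG t = record
  { rank = t
  ; E = λ v → not (isZero v)
  ; nonzero = pg-nonzero
  ; spanning = pg-span
  }

module Submission where

-- Let N = 2^r and let B be the complement of E. The claim is that if B meets every t-dimensional
-- subspace outside 0 and 2^t |B| < 3N, then some t linear functionals have no common zero in E.
--
-- For t = 2 the set A = E is sum-free with |A| > N/4. The third Fourier moment of a sum-free set
-- vanishes, which yields a hyperplane H with |A \ H| > N/6. If A ∩ H had an odd circuit, take a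
-- shortest one, of length 2k + 1: a second Fourier argument bounds |A \ H| by kN / 4(k + 1), and for
-- k ≥ 3 translates of A ∩ H by a binary code built on the circuit are disjoint, which
-- bounds |A ∩ H|; both bounds together contradict |A| > N/4. So A ∩ H has no odd circuit, and some
-- functional is 1 on all of it.
--
-- For t ≥ 3 fix a geometry P of dimension t - 3 in E. Either for some coset x + P ⊆ E the cosets v + P
-- with v + P and v + x + P in E form a sum-free set of density above 1/3, which then misses a
-- hyperplane, or all these densities are at most 1/3, and then the third moment of B + P gives a large
-- Fourier coefficient. In both cases there is a hyperplane H with |B ∩ H| ≥ 2^(1-t) N, so that
-- B \ H is too small to meet all cosets outside H of a (t-1)-dimensional geometry in E ∩ H.
-- Hence there is no such geometry, and induction applies to E ∩ H, pulled back along a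
-- projection onto H to keep the ambient dimension.

open import Defs
open import Data.Bool using (Bool; true; false; T; _xor_; _∧_; _∨_; not)
import Data.Bool
open import Data.Bool.Properties using (xor-comm; xor-assoc; xor-same; xor-identityʳ; not-involutive)
open import Data.Nat.Base as ℕ using (ℕ; zero; suc; z≤n; s≤s)
import Data.Nat.Properties as ℕ
import Data.Nat.Induction as ℕ
open import Data.Integer using (ℤ; +_; -[1+_]; -_; _+_; _-_; _*_; _≤_; _<_; +≤+; 0ℤ; 1ℤ)
open import Data.Integer.Properties
open import Data.Integer.Tactic.RingSolver using (solve-∀)
open import Data.Fin using (Fin; zero; suc; fromℕ<)
open import Data.Vec as Vec using (Vec; []; _∷_; lookup)
open import Data.Vec.Properties using (zipWith-comm; zipWith-assoc; ≡-dec)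
open import Data.Vec.Relation.Unary.All as VecAll using ([]; _∷_)
open import Data.List as List using (List; []; _∷_)
import Data.List.Properties as List
open import Data.List.Relation.Unary.All as All using (All; []; _∷_)
import Data.List.Relation.Unary.All.Properties as All
open import Data.List.Relation.Unary.Any using (here)
open import Data.List.Membership.Propositional using (_∈_)
open import Data.List.Membership.Propositional.Properties using (∈-map⁺; ∈-++⁺ˡ; ∈-++⁺ʳ; ∈-filter⁺)
open import Data.Product using (∃; _×_; _,_; proj₁; proj₂)
open import Data.Sum using (_⊎_; inj₁; inj₂)
open import Data.Empty using (⊥; ⊥-elim)
open import Function using (_∘_)
open import Induction.WellFounded using (Acc; acc)
open import Relation.Nullary using (¬_; Dec; yes; no; does)
open import Relation.Nullary.Decidable using (True; toWitness; _×-dec_; _⊎-dec_; _→-dec_; ¬?; map′; T?)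
open import Relation.Binary.PropositionalEquality

private
  variable
    m n r : ℕ

-- Vector arithmetic over the two-element field.

⊕-comm : (u v : F₂^ r) → u ⊕ v ≡ v ⊕ u
⊕-comm = zipWith-comm xor-comm

⊕-assoc : (u v w : F₂^ r) → (u ⊕ v) ⊕ w ≡ u ⊕ (v ⊕ w)
⊕-assoc = zipWith-assoc xor-assoc

⊕-identityˡ : (v : F₂^ r) → 𝟎 ⊕ v ≡ v
⊕-identityˡ []      = refl
⊕-identityˡ (x ∷ v) = cong (x ∷_) (⊕-identityˡ v)

⊕-identityʳ : (v : F₂^ r) → v ⊕ 𝟎 ≡ v
⊕-identityʳ v = trans (⊕-comm v 𝟎) (⊕-identityˡ v)

⊕-self : (v : F₂^ r) → v ⊕ v ≡ 𝟎
⊕-self []      = refl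
⊕-self (x ∷ v) = cong₂ _∷_ (xor-same x) (⊕-self v)

apply-𝟎 : (A : Matrix m n) → apply A 𝟎 ≡ 𝟎
apply-𝟎 []      = refl
apply-𝟎 (c ∷ A) = apply-𝟎 A

⊕-cancelʳ : (u v : F₂^ r) → (u ⊕ v) ⊕ v ≡ u
⊕-cancelʳ u v = trans (⊕-assoc u v v) (trans (cong (u ⊕_) (⊕-self v)) (⊕-identityʳ u))

⊕-cancelˡ : (u v : F₂^ r) → u ⊕ (u ⊕ v) ≡ v
⊕-cancelˡ u v = trans (sym (⊕-assoc u u v)) (trans (cong (_⊕ v) (⊕-self u)) (⊕-identityˡ v))

⊕-interchange : (a b c d : F₂^ r) → (a ⊕ b) ⊕ (c ⊕ d) ≡ (a ⊕ c) ⊕ (b ⊕ d)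
⊕-interchange a b c d = begin
  (a ⊕ b) ⊕ (c ⊕ d) ≡⟨ ⊕-assoc a b (c ⊕ d) ⟩
  a ⊕ (b ⊕ (c ⊕ d)) ≡⟨ cong (a ⊕_) (sym (⊕-assoc b c d)) ⟩
  a ⊕ ((b ⊕ c) ⊕ d) ≡⟨ cong (λ x → a ⊕ (x ⊕ d)) (⊕-comm b c) ⟩
  a ⊕ ((c ⊕ b) ⊕ d) ≡⟨ cong (a ⊕_) (⊕-assoc c b d) ⟩
  a ⊕ (c ⊕ (b ⊕ d)) ≡⟨ sym (⊕-assoc a c (b ⊕ d)) ⟩
  (a ⊕ c) ⊕ (b ⊕ d) ∎
  where open ≡-Reasoning

⊕≡𝟎⇒≡ : (u v : F₂^ r) → u ⊕ v ≡ 𝟎 → u ≡ v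
⊕≡𝟎⇒≡ u v e = trans (sym (⊕-cancelʳ u v)) (trans (cong (_⊕ v) e) (⊕-identityˡ v))

apply-⊕ : (A : Matrix m n) (x y : F₂^ n) → apply A (x ⊕ y) ≡ apply A x ⊕ apply A y
apply-⊕ []      []          []          = sym (⊕-self 𝟎)
apply-⊕ (c ∷ A) (false ∷ x) (false ∷ y) = apply-⊕ A x y
apply-⊕ (c ∷ A) (false ∷ x) (true ∷ y)  = begin
  c ⊕ apply A (x ⊕ y)             ≡⟨ cong (c ⊕_) (apply-⊕ A x y) ⟩
  c ⊕ (apply A x ⊕ apply A y)     ≡⟨ sym (⊕-assoc c _ _) ⟩
  (c ⊕ apply A x) ⊕ apply A y     ≡⟨ cong (_⊕ apply A y) (⊕-comm c _) ⟩
  (apply A x ⊕ c) ⊕ apply A y     ≡⟨ ⊕-assoc _ c _ ⟩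
  apply A x ⊕ (c ⊕ apply A y)     ∎
  where open ≡-Reasoning
apply-⊕ (c ∷ A) (true ∷ x)  (false ∷ y) =
  trans (cong (c ⊕_) (apply-⊕ A x y)) (sym (⊕-assoc c _ _))
apply-⊕ (c ∷ A) (true ∷ x)  (true ∷ y)  = begin
  apply A (x ⊕ y)                     ≡⟨ apply-⊕ A x y ⟩
  apply A x ⊕ apply A y               ≡⟨ sym (⊕-identityˡ _) ⟩
  𝟎 ⊕ (apply A x ⊕ apply A y)         ≡⟨ cong (_⊕ _) (sym (⊕-self c)) ⟩
  (c ⊕ c) ⊕ (apply A x ⊕ apply A y)   ≡⟨ ⊕-interchange c c _ _ ⟩
  (c ⊕ apply A x) ⊕ (c ⊕ apply A y)   ∎
  where open ≡-Reasoning

-- A reflective solver for xor identities.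

data XorExpr (n : ℕ) : Set where
  var  : Fin n → XorExpr n
  _:⊕_ : XorExpr n → XorExpr n → XorExpr n

infixl 6 _:⊕_
infix 8 #_

#_ : ∀ i {i<n : True (i ℕ.<? n)} → XorExpr n
#_ i {i<n} = var (fromℕ< (toWitness i<n))

unit : Fin n → F₂^ n
unit zero    = true ∷ 𝟎
unit (suc i) = false ∷ unit i

apply-unit : (A : Matrix m n) (i : Fin n) → apply A (unit i) ≡ lookup A i
apply-unit (c ∷ A) zero    = trans (cong (c ⊕_) (apply-𝟎 A)) (⊕-identityʳ c)
apply-unit (c ∷ A) (suc i) = apply-unit A i

⟦_⟧ : XorExpr n → Matrix m n → F₂^ m
⟦ var i ⟧  ρ = lookup ρ i
⟦ e :⊕ f ⟧ ρ = ⟦ e ⟧ ρ ⊕ ⟦ f ⟧ ρ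

normalise : XorExpr n → F₂^ n
normalise (var i)  = unit i
normalise (e :⊕ f) = normalise e ⊕ normalise f

normalise-correct : (e : XorExpr n) (ρ : Matrix m n) → apply ρ (normalise e) ≡ ⟦ e ⟧ ρ
normalise-correct (var i)  ρ = apply-unit ρ i
normalise-correct (e :⊕ f) ρ =
  trans (apply-⊕ ρ _ _) (cong₂ _⊕_ (normalise-correct e ρ) (normalise-correct f ρ))

-- Evaluating an expression is applying the linear map with columns `ρ` to its vector of occurrence
-- parities, so for concrete expressions the premise is `refl`.
xor-solve : (ρ : Matrix m n) (e f : XorExpr n) → normalise e ≡ normalise f → ⟦ e ⟧ ρ ≡ ⟦ f ⟧ ρ
xor-solve ρ e f eq =
  trans (sym (normalise-correct e ρ)) (trans (cong (apply ρ) eq) (normalise-correct f ρ))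

-- Linear functionals and characters

infix 7 _·_

_·_ : F₂^ r → F₂^ r → Bool
[]          · []      = false
(false ∷ a) · (x ∷ v) = a · v
(true ∷ a)  · (x ∷ v) = x xor (a · v)

xor-interchange : ∀ a b c d → (a xor b) xor (c xor d) ≡ (a xor c) xor (b xor d)
xor-interchange a b c d = begin
  (a xor b) xor (c xor d) ≡⟨ xor-assoc a b (c xor d) ⟩
  a xor (b xor (c xor d)) ≡⟨ cong (a xor_) (sym (xor-assoc b c d)) ⟩
  a xor ((b xor c) xor d) ≡⟨ cong (λ x → a xor (x xor d)) (xor-comm b c) ⟩
  a xor ((c xor b) xor d) ≡⟨ cong (a xor_) (xor-assoc c b d) ⟩
  a xor (c xor (b xor d)) ≡⟨ sym (xor-assoc a c (b xor d)) ⟩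
  (a xor c) xor (b xor d) ∎
  where open ≡-Reasoning

·-⊕ʳ : (a u v : F₂^ r) → a · (u ⊕ v) ≡ (a · u) xor (a · v)
·-⊕ʳ []          []      []      = refl
·-⊕ʳ (false ∷ a) (x ∷ u) (y ∷ v) = ·-⊕ʳ a u v
·-⊕ʳ (true ∷ a)  (x ∷ u) (y ∷ v) =
  trans (cong ((x xor y) xor_) (·-⊕ʳ a u v)) (xor-interchange x y (a · u) (a · v))

·-⊕ˡ : (a b v : F₂^ r) → (a ⊕ b) · v ≡ (a · v) xor (b · v)
·-⊕ˡ []          []          []      = refl
·-⊕ˡ (false ∷ a) (false ∷ b) (x ∷ v) = ·-⊕ˡ a b v
·-⊕ˡ (false ∷ a) (true ∷ b)  (x ∷ v) = begin
  x xor ((a ⊕ b) · v)           ≡⟨ cong (x xor_) (·-⊕ˡ a b v) ⟩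
  x xor ((a · v) xor (b · v))   ≡⟨ sym (xor-assoc x (a · v) _) ⟩
  (x xor (a · v)) xor (b · v)   ≡⟨ cong (_xor (b · v)) (xor-comm x (a · v)) ⟩
  ((a · v) xor x) xor (b · v)   ≡⟨ xor-assoc (a · v) x _ ⟩
  (a · v) xor (x xor (b · v))   ∎
  where open ≡-Reasoning
·-⊕ˡ (true ∷ a)  (false ∷ b) (x ∷ v) =
  trans (cong (x xor_) (·-⊕ˡ a b v)) (sym (xor-assoc x (a · v) _))
·-⊕ˡ (true ∷ a)  (true ∷ b)  (x ∷ v) = begin
  (a ⊕ b) · v                               ≡⟨ ·-⊕ˡ a b v ⟩
  (a · v) xor (b · v)                       ≡⟨ cong (_xor ((a · v) xor (b · v))) (sym (xor-same x)) ⟩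
  (x xor x) xor ((a · v) xor (b · v))       ≡⟨ xor-interchange x x (a · v) (b · v) ⟩
  (x xor (a · v)) xor (x xor (b · v))       ∎
  where open ≡-Reasoning

·-𝟎ʳ : (a : F₂^ r) → a · 𝟎 ≡ false
·-𝟎ʳ []          = refl
·-𝟎ʳ (false ∷ a) = ·-𝟎ʳ a
·-𝟎ʳ (true ∷ a)  = ·-𝟎ʳ a

·-𝟎ˡ : (v : F₂^ r) → 𝟎 · v ≡ false
·-𝟎ˡ []      = refl
·-𝟎ˡ (x ∷ v) = ·-𝟎ˡ v

sgn : Bool → ℤ
sgn false = 1ℤ
sgn true  = - 1ℤ

sgn-xor : ∀ a b → sgn (a xor b) ≡ sgn a * sgn b
sgn-xor false false = refl
sgn-xor false true  = refl
sgn-xor true  false = refl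
sgn-xor true  true  = refl

χ : F₂^ r → F₂^ r → ℤ
χ a v = sgn (a · v)

χ-⊕ : (a u v : F₂^ r) → χ a (u ⊕ v) ≡ χ a u * χ a v
χ-⊕ a u v = trans (cong sgn (·-⊕ʳ a u v)) (sgn-xor (a · u) (a · v))

χ-𝟎ˡ : (v : F₂^ r) → χ 𝟎 v ≡ 1ℤ
χ-𝟎ˡ v = cong sgn (·-𝟎ˡ v)

-- Summation over F₂^ r

∑ : (F₂^ r → ℤ) → ℤ
∑ {zero}  f = f []
∑ {suc r} f = ∑ (f ∘ (false ∷_)) + ∑ (f ∘ (true ∷_))

∑-cong : {f g : F₂^ r → ℤ} → (∀ v → f v ≡ g v) → ∑ f ≡ ∑ g
∑-cong {zero}  e = e []
∑-cong {suc r} e = cong₂ _+_ (∑-cong (e ∘ (false ∷_))) (∑-cong (e ∘ (true ∷_)))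

+-interchange : ∀ a b c d → (a + b) + (c + d) ≡ (a + c) + (b + d)
+-interchange = solve-∀

∑-+ : (f g : F₂^ r → ℤ) → ∑ (λ v → f v + g v) ≡ ∑ f + ∑ g
∑-+ {zero}  f g = refl
∑-+ {suc r} f g =
  trans (cong₂ _+_ (∑-+ (f ∘ (false ∷_)) (g ∘ (false ∷_))) (∑-+ (f ∘ (true ∷_)) (g ∘ (true ∷_))))
        (+-interchange (∑ (f ∘ (false ∷_))) _ _ _)

∑-*ˡ : (c : ℤ) (f : F₂^ r → ℤ) → ∑ (λ v → c * f v) ≡ c * ∑ f
∑-*ˡ {zero}  c f = refl
∑-*ˡ {suc r} c f =
  trans (cong₂ _+_ (∑-*ˡ c (f ∘ (false ∷_))) (∑-*ˡ c (f ∘ (true ∷_))))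
        (sym (*-distribˡ-+ c (∑ (f ∘ (false ∷_))) _))

∑-*ʳ : (c : ℤ) (f : F₂^ r → ℤ) → ∑ (λ v → f v * c) ≡ ∑ f * c
∑-*ʳ c f = trans (∑-cong (λ v → *-comm (f v) c)) (trans (∑-*ˡ c f) (*-comm c (∑ f)))

∑-neg : (f : F₂^ r → ℤ) → ∑ (λ v → - f v) ≡ - ∑ f
∑-neg {zero}  f = refl
∑-neg {suc r} f =
  trans (cong₂ _+_ (∑-neg (f ∘ (false ∷_))) (∑-neg (f ∘ (true ∷_))))
        (sym (neg-distrib-+ (∑ (f ∘ (false ∷_))) _))

∑-- : (f g : F₂^ r → ℤ) → ∑ (λ v → f v - g v) ≡ ∑ f - ∑ g
∑-- f g = trans (∑-+ f (λ v → - g v)) (cong (_+_ (∑ f)) (∑-neg g))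

∑-mono : {f g : F₂^ r → ℤ} → (∀ v → f v ≤ g v) → ∑ f ≤ ∑ g
∑-mono {zero}  e = e []
∑-mono {suc r} e = +-mono-≤ (∑-mono (e ∘ (false ∷_))) (∑-mono (e ∘ (true ∷_)))

card : ℕ → ℤ
card r = + (2 ℕ.^ r)

card-suc : ∀ r → card (suc r) ≡ card r + card r
card-suc r = cong +_ (cong (2 ℕ.^ r ℕ.+_) (ℕ.+-identityʳ (2 ℕ.^ r)))

∑-const : ∀ c → ∑ {r} (λ _ → c) ≡ c * card r
∑-const {zero}  c = sym (*-identityʳ c)
∑-const {suc r} c =
  trans (cong₂ _+_ (∑-const {r} c) (∑-const {r} c))
        (trans (sym (*-distribˡ-+ c (card r) (card r))) (cong (c *_) (sym (card-suc r))))

∑-shift : (f : F₂^ r → ℤ) (w : F₂^ r) → ∑ (λ v → f (v ⊕ w)) ≡ ∑ f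
∑-shift {zero}  f []          = refl
∑-shift {suc r} f (false ∷ w) = cong₂ _+_ (∑-shift (f ∘ (false ∷_)) w) (∑-shift (f ∘ (true ∷_)) w)
∑-shift {suc r} f (true ∷ w)  =
  trans (cong₂ _+_ (∑-shift (f ∘ (true ∷_)) w) (∑-shift (f ∘ (false ∷_)) w))
        (+-comm (∑ (f ∘ (true ∷_))) _)

∑-swap : (f : F₂^ m → F₂^ n → ℤ) → ∑ (λ u → ∑ (f u)) ≡ ∑ (λ v → ∑ (λ u → f u v))
∑-swap {zero}  f = refl
∑-swap {suc m} f =
  trans (cong₂ _+_ (∑-swap (f ∘ (false ∷_))) (∑-swap (f ∘ (true ∷_))))
        (sym (∑-+ (λ v → ∑ (λ u → f (false ∷ u) v)) _))

∑-nonNeg : {f : F₂^ r → ℤ} → (∀ v → 0ℤ ≤ f v) → 0ℤ ≤ ∑ f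
∑-nonNeg {zero}  p = p []
∑-nonNeg {suc r} p = +-mono-≤ (∑-nonNeg (p ∘ (false ∷_))) (∑-nonNeg (p ∘ (true ∷_)))

-- In the moment arguments this keeps the trivial character and discards all others; the term kept
-- may itself be negative.
∑-≥-𝟎 : (f : F₂^ r → ℤ) → (∀ v → v ≢ 𝟎 → 0ℤ ≤ f v) → f 𝟎 ≤ ∑ f
∑-≥-𝟎 {zero}  f p = ≤-refl
∑-≥-𝟎 {suc r} f p =
  subst (_≤ ∑ f) (+-identityʳ _)
    (+-mono-≤ (∑-≥-𝟎 (f ∘ (false ∷_)) (λ v v≢0 → p (false ∷ v) λ { refl → v≢0 refl }))
              (∑-nonNeg (λ v → p (true ∷ v) λ ())))

-- Exhaustive search and counting.

search : (P : F₂^ r → Bool) → (∃ λ v → P v ≡ true) ⊎ (∀ v → P v ≡ false)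
search {zero} P with P [] in eq
... | true  = inj₁ ([] , eq)
... | false = inj₂ λ { [] → eq }
search {suc r} P with search (P ∘ (false ∷_)) | search (P ∘ (true ∷_))
... | inj₁ (v , e) | _            = inj₁ (false ∷ v , e)
... | inj₂ _       | inj₁ (v , e) = inj₁ (true ∷ v , e)
... | inj₂ p       | inj₂ q       = inj₂ λ { (false ∷ v) → p v ; (true ∷ v) → q v }

any? : (F₂^ r → Bool) → Bool
any? P with search P
... | inj₁ _ = true
... | inj₂ _ = false

any?-witness : (P : F₂^ r → Bool) → any? P ≡ true → ∃ λ v → P v ≡ true
any?-witness P e with search P
... | inj₁ w = w

any?-none : (P : F₂^ r → Bool) → any? P ≡ false → ∀ v → P v ≡ false
any?-none P e with search P
... | inj₂ p = p

ind : Bool → ℤ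
ind false = 0ℤ
ind true  = 1ℤ

∣_∣ : (F₂^ r → Bool) → ℤ
∣ P ∣ = ∑ (ind ∘ P)

ind-≥0 : ∀ b → 0ℤ ≤ ind b
ind-≥0 false = ≤-refl
ind-≥0 true  = +≤+ z≤n

ind-≤1 : ∀ b → ind b ≤ 1ℤ
ind-≤1 false = +≤+ z≤n
ind-≤1 true  = ≤-refl

ind-not : ∀ b → ind (not b) ≡ 1ℤ - ind b
ind-not false = refl
ind-not true  = refl

∣∣-≥0 : (P : F₂^ r → Bool) → 0ℤ ≤ ∣ P ∣
∣∣-≥0 P = ∑-nonNeg (ind-≥0 ∘ P)

∣∣-not : (P : F₂^ r → Bool) → ∣ not ∘ P ∣ ≡ card r - ∣ P ∣
∣∣-not {r} P =
  trans (∑-cong (ind-not ∘ P))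
        (trans (∑-- (λ _ → 1ℤ) (ind ∘ P)) (cong (_- ∣ P ∣) (trans (∑-const {r} 1ℤ) (*-identityˡ _))))

∣∣-false : {P : F₂^ r → Bool} → (∀ v → P v ≡ false) → ∣ P ∣ ≡ 0ℤ
∣∣-false {r} p = trans (∑-cong (λ v → cong ind (p v))) (trans (∑-const {r} 0ℤ) (*-zeroˡ (card r)))

ind-mono : ∀ {a b} → (a ≡ true → b ≡ true) → ind a ≤ ind b
ind-mono {false} {b} p = ind-≥0 b
ind-mono {true}  {b} p rewrite p refl = ≤-refl

ind-any? : (P : F₂^ r → Bool) → ind (any? P) ≤ ∣ P ∣
ind-any? P with search P
... | inj₂ _       = ∣∣-≥0 P
-- Translating by the witness moves it to the origin, where `∑-≥-𝟎` applies.
... | inj₁ (w , e) = subst₂ _≤_ (cong ind (trans (cong P (⊕-identityˡ w)) e)) (∑-shift (ind ∘ P) w)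
                       (∑-≥-𝟎 (λ v → ind (P (v ⊕ w))) (λ v _ → ind-≥0 (P (v ⊕ w))))

∣∣-unique : (P : F₂^ r → Bool) → (∀ u v → P u ≡ true → P v ≡ true → u ≡ v) → ∣ P ∣ ≤ 1ℤ
∣∣-unique {zero}  P p = ind-≤1 (P [])
∣∣-unique {suc r} P p with search (P ∘ (false ∷_))
... | inj₁ (w , e) =
  +-mono-≤ (∣∣-unique (P ∘ (false ∷_)) (λ u v a b → tail≡ (p _ _ a b)))
           (≤-reflexive (∣∣-false {P = P ∘ (true ∷_)} none))
  where
  tail≡ : ∀ {x y} {u v : F₂^ r} → x ∷ u ≡ y ∷ v → u ≡ v
  tail≡ refl = refl
  none : ∀ v → P (true ∷ v) ≡ false
  none v with P (true ∷ v) in eq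
  ... | false = refl
  ... | true with p _ _ e eq
  ...   | ()
... | inj₂ q =
  +-mono-≤ (≤-reflexive (∣∣-false {P = P ∘ (false ∷_)} q))
           (∣∣-unique (P ∘ (true ∷_)) (λ u v a b → tail≡ (p _ _ a b)))
  where
  tail≡ : ∀ {x y} {u v : F₂^ r} → x ∷ u ≡ y ∷ v → u ≡ v
  tail≡ refl = refl

length-filter-map : {A B : Set} (f : A → B) (P : B → Bool) (xs : List A) →
  List.length (List.filter (λ x → P x Data.Bool.≟ true) (List.map f xs))
    ≡ List.length (List.filter (λ x → P (f x) Data.Bool.≟ true) xs)
length-filter-map f P []       = refl
length-filter-map f P (x ∷ xs) with P (f x)
... | true  = cong suc (length-filter-map f P xs)
... | false = length-filter-map f P xs

count≡∣∣ : (P : F₂^ r → Bool) → + count P ≡ ∣ P ∣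
count≡∣∣ {zero} P with P []
... | true  = refl
... | false = refl
count≡∣∣ {suc r} P = begin
  + count P
    ≡⟨ cong (+_ ∘ List.length) (List.filter-++ P? (List.map (false ∷_) (allVecs r)) _) ⟩
  + List.length (List.filter P? (List.map (false ∷_) (allVecs r)) List.++ List.filter P? (List.map (true ∷_) (allVecs r)))
    ≡⟨ cong +_ (List.length-++ (List.filter P? (List.map (false ∷_) (allVecs r)))) ⟩
  + (List.length (List.filter P? (List.map (false ∷_) (allVecs r))) ℕ.+ List.length (List.filter P? (List.map (true ∷_) (allVecs r))))
    ≡⟨ cong +_ (cong₂ ℕ._+_ (length-filter-map (false ∷_) P (allVecs r)) (length-filter-map (true ∷_) P (allVecs r))) ⟩
  + (count (P ∘ (false ∷_)) ℕ.+ count (P ∘ (true ∷_)))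
    ≡⟨ cong₂ _+_ (count≡∣∣ (P ∘ (false ∷_))) (count≡∣∣ (P ∘ (true ∷_))) ⟩
  ∣ P ∣ ∎
  where
  open ≡-Reasoning
  P? = λ v → P v Data.Bool.≟ true

-- Inequalities between integers.

+-nonNeg : ∀ {i j} → 0ℤ ≤ i → 0ℤ ≤ j → 0ℤ ≤ i + j
+-nonNeg = +-mono-≤

*-nonNeg : ∀ {i j} → 0ℤ ≤ i → 0ℤ ≤ j → 0ℤ ≤ i * j
*-nonNeg {+ m} {+ n} _ _ = subst (0ℤ ≤_) (pos-* m n) (+≤+ z≤n)

square-nonNeg : ∀ i → 0ℤ ≤ i * i
square-nonNeg (+ n)    = *-nonNeg {+ n} {+ n} (+≤+ z≤n) (+≤+ z≤n)
square-nonNeg -[1+ n ] = +≤+ z≤n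

slack : ∀ {i j} → i ≤ j → 0ℤ ≤ j - i
slack = i≤j⇒0≤j-i

slack< : ∀ {i j} → i < j → 0ℤ ≤ j - i - 1ℤ
slack< {i} {j} i<j = subst (0ℤ ≤_) (rearrange i j) (slack (i<j⇒suc[i]≤j i<j))
  where
  rearrange : ∀ i j → j - (1ℤ + i) ≡ j - i - 1ℤ
  rearrange = solve-∀

-- Inequalities are proved by writing the difference of the two sides, or a negative number,
-- as a combination of quantities known to be nonnegative. The lemmas are opaque because
-- Agda would otherwise evaluate the ring normalisation proofs passed to them.
opaque
  ≤-by : ∀ {i j k} → 0ℤ ≤ k → k ≡ j - i → i ≤ j
  ≤-by p refl = 0≤i-j⇒j≤i p

  negative-absurd : ∀ {k} → 0ℤ ≤ k → k ≡ - 1ℤ → ⊥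
  negative-absurd p refl with p
  ... | ()

0≤1 : 0ℤ ≤ 1ℤ
0≤1 = +≤+ z≤n

0≤card : ∀ r → 0ℤ ≤ card r
0≤card r = +≤+ z≤n

1≤card : ∀ r → 1ℤ ≤ card r
1≤card r = +≤+ (ℕ.m^n>0 2 r)

-- Fourier analysis on F₂^r

fourier : (F₂^ r → ℤ) → F₂^ r → ℤ
fourier f a = ∑ (λ v → f v * χ a v)

-- Fourier inversion at the origin, by induction on `r`: the two values of the leading coordinate of
-- `a` give `f₁` opposite signs, so only `f₀` survives, counted twice.
∑-fourier : (f : F₂^ r → ℤ) → ∑ (fourier f) ≡ card r * f 𝟎
∑-fourier {zero}  f = *-comm (f []) 1ℤ
∑-fourier {suc r} f = begin
  ∑ (λ a → fourier f₀ a + fourier f₁ a) + ∑ (λ a → fourier f₀ a + ∑ (λ v → f₁ v * sgn (not (a · v))))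
    ≡⟨ cong (_+_ (∑ (λ a → fourier f₀ a + fourier f₁ a))) (∑-cong λ a → cong (_+_ (fourier f₀ a)) (flip a)) ⟩
  ∑ (λ a → fourier f₀ a + fourier f₁ a) + ∑ (λ a → fourier f₀ a - fourier f₁ a)
    ≡⟨ cong₂ _+_ (∑-+ (fourier f₀) (fourier f₁)) (∑-- (fourier f₀) (fourier f₁)) ⟩
  (∑ (fourier f₀) + ∑ (fourier f₁)) + (∑ (fourier f₀) - ∑ (fourier f₁))
    ≡⟨ double (∑ (fourier f₀)) _ ⟩
  ∑ (fourier f₀) + ∑ (fourier f₀)
    ≡⟨ cong₂ _+_ (∑-fourier f₀) (∑-fourier f₀) ⟩
  card r * f₀ 𝟎 + card r * f₀ 𝟎
    ≡⟨ sym (*-distribʳ-+ (f₀ 𝟎) (card r) (card r)) ⟩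
  (card r + card r) * f₀ 𝟎
    ≡⟨ cong (_* f₀ 𝟎) (sym (card-suc r)) ⟩
  card (suc r) * f 𝟎 ∎
  where
  open ≡-Reasoning
  f₀ = f ∘ (false ∷_)
  f₁ = f ∘ (true ∷_)
  double : ∀ x y → (x + y) + (x - y) ≡ x + x
  double = solve-∀
  sgn-not : ∀ b → sgn (not b) ≡ - sgn b
  sgn-not false = refl
  sgn-not true  = refl
  flip : ∀ a → ∑ (λ v → f₁ v * sgn (not (a · v))) ≡ - fourier f₁ a
  flip a = trans
    (∑-cong λ v → trans (cong (f₁ v *_) (sgn-not (a · v))) (sym (neg-distribʳ-* (f₁ v) (χ a v))))
    (∑-neg (λ v → f₁ v * χ a v))

conv : (F₂^ r → ℤ) → (F₂^ r → ℤ) → F₂^ r → ℤ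
conv f g y = ∑ (λ x → f x * g (x ⊕ y))

χ-square : (a v : F₂^ r) → χ a v * χ a v ≡ 1ℤ
χ-square a v with a · v
... | false = refl
... | true  = refl

-- The convolution theorem: recentre the second sum at `x`, after which the two factors `χ a x`
-- cancel.
fourier-conv : (f g : F₂^ r → ℤ) (a : F₂^ r) → fourier f a * fourier g a ≡ fourier (conv f g) a
fourier-conv f g a = begin
  ∑ (λ x → f x * χ a x) * fourier g a
    ≡⟨ sym (∑-*ʳ (fourier g a) (λ x → f x * χ a x)) ⟩
  ∑ (λ x → (f x * χ a x) * fourier g a)
    ≡⟨ ∑-cong (λ x → trans (cong ((f x * χ a x) *_) (recentre x)) (sym (∑-*ˡ (f x * χ a x) (λ y → g (x ⊕ y) * χ a (x ⊕ y))))) ⟩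
  ∑ (λ x → ∑ (λ y → (f x * χ a x) * (g (x ⊕ y) * χ a (x ⊕ y))))
    ≡⟨ ∑-cong (λ x → ∑-cong (λ y → pointwise x y)) ⟩
  ∑ (λ x → ∑ (λ y → f x * g (x ⊕ y) * χ a y))
    ≡⟨ ∑-swap (λ x y → f x * g (x ⊕ y) * χ a y) ⟩
  ∑ (λ y → ∑ (λ x → f x * g (x ⊕ y) * χ a y))
    ≡⟨ ∑-cong (λ y → ∑-*ʳ (χ a y) (λ x → f x * g (x ⊕ y))) ⟩
  fourier (conv f g) a ∎
  where
  open ≡-Reasoning
  recentre : ∀ x → fourier g a ≡ ∑ (λ y → g (x ⊕ y) * χ a (x ⊕ y))
  recentre x = trans (sym (∑-shift (λ y → g y * χ a y) x))
                     (∑-cong (λ y → cong (λ z → g z * χ a z) (⊕-comm y x)))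
  regroup : ∀ p q s t → (p * q) * (s * (q * t)) ≡ (p * s * t) * (q * q)
  regroup = solve-∀
  pointwise : ∀ x y → (f x * χ a x) * (g (x ⊕ y) * χ a (x ⊕ y)) ≡ f x * g (x ⊕ y) * χ a y
  pointwise x y = begin
    (f x * χ a x) * (g (x ⊕ y) * χ a (x ⊕ y))
      ≡⟨ cong (λ z → (f x * χ a x) * (g (x ⊕ y) * z)) (χ-⊕ a x y) ⟩
    (f x * χ a x) * (g (x ⊕ y) * (χ a x * χ a y))
      ≡⟨ regroup (f x) (χ a x) (g (x ⊕ y)) (χ a y) ⟩
    (f x * g (x ⊕ y) * χ a y) * (χ a x * χ a x)
      ≡⟨ cong ((f x * g (x ⊕ y) * χ a y) *_) (χ-square a x) ⟩
    (f x * g (x ⊕ y) * χ a y) * 1ℤ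
      ≡⟨ *-identityʳ _ ⟩
    f x * g (x ⊕ y) * χ a y ∎

-- Multiplying a transform by `χ a y` translates the function by `y`, so this is inversion at the
-- origin for a translate of `conv f f`.
∑-fourier²-χ : (f : F₂^ r → ℤ) (y : F₂^ r) →
  ∑ (λ a → fourier f a * fourier f a * χ a y) ≡ card r * conv f f y
∑-fourier²-χ {r} f y = begin
  ∑ (λ a → fourier f a * fourier f a * χ a y) ≡⟨ ∑-cong (λ a → cong (_* χ a y) (fourier-conv f f a)) ⟩
  ∑ (λ a → fourier h a * χ a y)               ≡⟨ ∑-cong modulate ⟩
  ∑ (fourier (λ v → h (v ⊕ y)))               ≡⟨ ∑-fourier (λ v → h (v ⊕ y)) ⟩
  card r * h (𝟎 ⊕ y)                          ≡⟨ cong (λ z → card r * h z) (⊕-identityˡ y) ⟩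
  card r * h y                                ∎
  where
  open ≡-Reasoning
  h = conv f f
  cancel : ∀ p q s → p * (q * s) * s ≡ p * q * (s * s)
  cancel = solve-∀
  modulate : ∀ a → fourier h a * χ a y ≡ fourier (λ v → h (v ⊕ y)) a
  modulate a = begin
    fourier h a * χ a y
      ≡⟨ cong (_* χ a y) (sym (∑-shift (λ v → h v * χ a v) y)) ⟩
    ∑ (λ v → h (v ⊕ y) * χ a (v ⊕ y)) * χ a y
      ≡⟨ sym (∑-*ʳ (χ a y) (λ v → h (v ⊕ y) * χ a (v ⊕ y))) ⟩
    ∑ (λ v → h (v ⊕ y) * χ a (v ⊕ y) * χ a y)
      ≡⟨ ∑-cong (λ v → trans (cong (λ z → h (v ⊕ y) * z * χ a y) (χ-⊕ a v y))
           (trans (cancel (h (v ⊕ y)) (χ a v) (χ a y))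
             (trans (cong (h (v ⊕ y) * χ a v *_) (χ-square a y)) (*-identityʳ _)))) ⟩
    fourier (λ v → h (v ⊕ y)) a ∎

∑-fourier² : (f : F₂^ r → ℤ) → ∑ (λ a → fourier f a * fourier f a) ≡ card r * conv f f 𝟎
∑-fourier² f = trans
  (∑-cong (λ a → sym (trans (cong (λ z → fourier f a * fourier f a * sgn z) (·-𝟎ʳ a)) (*-identityʳ _))))
  (∑-fourier²-χ f 𝟎)

-- For an indicator function the right-hand sum counts the pairs `x`, `u` with `x`, `u` and `u ⊕ x`
-- all in the set.
∑-fourier³ : (f : F₂^ r → ℤ) →
  ∑ (λ a → fourier f a * (fourier f a * fourier f a)) ≡ card r * ∑ (λ x → f x * conv f f x)
∑-fourier³ {r} f = begin
  ∑ (λ a → fourier f a * (fourier f a * fourier f a))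
    ≡⟨ ∑-cong (λ a → trans (cong (fourier f a *_) (fourier-conv f f a)) (fourier-conv f (conv f f) a)) ⟩
  ∑ (fourier (conv f (conv f f)))
    ≡⟨ ∑-fourier (conv f (conv f f)) ⟩
  card r * ∑ (λ x → f x * conv f f (x ⊕ 𝟎))
    ≡⟨ cong (card r *_) (∑-cong (λ x → cong (λ z → f x * conv f f z) (⊕-identityʳ x))) ⟩
  card r * ∑ (λ x → f x * conv f f x) ∎
  where open ≡-Reasoning

fourier-𝟎 : (f : F₂^ r → ℤ) → fourier f 𝟎 ≡ ∑ f
fourier-𝟎 f = ∑-cong (λ v → trans (cong (f v *_) (χ-𝟎ˡ v)) (*-identityʳ (f v)))

ind-square : ∀ b → ind b * ind b ≡ ind b
ind-square false = refl
ind-square true  = refl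

conv-ind-𝟎 : (P : F₂^ r → Bool) → conv (ind ∘ P) (ind ∘ P) 𝟎 ≡ ∣ P ∣
conv-ind-𝟎 P = ∑-cong (λ x → trans (cong (λ z → ind (P x) * ind (P z)) (⊕-identityʳ x)) (ind-square (P x)))

infix 10 _∣₁_ _∣₀_

_∣₁_ _∣₀_ : (F₂^ r → Bool) → F₂^ r → F₂^ r → Bool
(P ∣₁ a) v = P v ∧ a · v
(P ∣₀ a) v = P v ∧ not (a · v)

∣∣-split : (P : F₂^ r → Bool) (a : F₂^ r) → ∣ P ∣ ≡ ∣ P ∣₀ a ∣ + ∣ P ∣₁ a ∣
∣∣-split P a = trans (∑-cong pointwise) (∑-+ (ind ∘ P ∣₀ a) (ind ∘ P ∣₁ a))
  where
  pointwise : ∀ v → ind (P v) ≡ ind (P v ∧ not (a · v)) + ind (P v ∧ a · v)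
  pointwise v with P v | a · v
  ... | false | _     = refl
  ... | true  | false = refl
  ... | true  | true  = refl

fourier-ind : (P : F₂^ r → Bool) (a : F₂^ r) → fourier (ind ∘ P) a ≡ ∣ P ∣₀ a ∣ - ∣ P ∣₁ a ∣
fourier-ind P a = trans (∑-cong pointwise) (∑-- (ind ∘ P ∣₀ a) (ind ∘ P ∣₁ a))
  where
  pointwise : ∀ v → ind (P v) * sgn (a · v) ≡ ind (P v ∧ not (a · v)) - ind (P v ∧ a · v)
  pointwise v with P v | a · v
  ... | false | false = refl
  ... | false | true  = refl
  ... | true  | false = refl
  ... | true  | true  = refl

SumFree : (F₂^ r → Bool) → Set
SumFree A = ∀ u v → A u ≡ true → A v ≡ true → A (u ⊕ v) ≡ true → ⊥

sumFree⇒conv≡0 : (A : F₂^ r → Bool) → SumFree A →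
  ∀ x → A x ≡ true → conv (ind ∘ A) (ind ∘ A) x ≡ 0ℤ
sumFree⇒conv≡0 {r} A sf x Ax =
  trans (∑-cong pointwise) (trans (∑-const {r} 0ℤ) (*-zeroˡ (card r)))
  where
  pointwise : ∀ v → ind (A v) * ind (A (v ⊕ x)) ≡ 0ℤ
  pointwise v with A v in Av | A (v ⊕ x) in Avx
  ... | false | _     = refl
  ... | true  | false = refl
  ... | true  | true  = ⊥-elim (sf v x Av Ax Avx)

-- The third moment of the Fourier transform of a sum-free set vanishes, so the trivial
-- character must be compensated by a very negative coefficient.
sumFree⇒bias : (A : F₂^ r → Bool) → SumFree A → 1ℤ ≤ ∣ A ∣ →
  ∃ λ a → ∣ A ∣ * card r ≤ + 2 * ∣ A ∣₁ a ∣ * (card r - ∣ A ∣)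
sumFree⇒bias {r} A sf 1≤s with search (λ a → does (fourier (ind ∘ A) a * (card r - ∣ A ∣) + ∣ A ∣ * ∣ A ∣ ≤? 0ℤ))
... | inj₁ (a , e) with fourier (ind ∘ A) a * (card r - ∣ A ∣) + ∣ A ∣ * ∣ A ∣ ≤? 0ℤ
...   | yes p = a , ≤-by (slack p) (begin
          0ℤ - (F a * (N - s) + s * s)
            ≡⟨ cong (λ z → 0ℤ - (z * (N - s) + s * s)) (fourier-ind A a) ⟩
          0ℤ - ((z - c) * (N - s) + s * s)
            ≡⟨ cong (λ s → 0ℤ - ((z - c) * (N - s) + s * s)) (∣∣-split A a) ⟩
          0ℤ - ((z - c) * (N - (z + c)) + (z + c) * (z + c))
            ≡⟨ identity z c N ⟩
          + 2 * c * (N - (z + c)) - (z + c) * N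
            ≡⟨ cong (λ s → + 2 * c * (N - s) - s * N) (sym (∣∣-split A a)) ⟩
          + 2 * c * (N - s) - s * N ∎)
  where
  open ≡-Reasoning
  F = fourier (ind ∘ A)
  N = card r
  s = ∣ A ∣
  z = ∣ A ∣₀ a ∣
  c = ∣ A ∣₁ a ∣
  identity : ∀ z c N → 0ℤ - ((z - c) * (N - (z + c)) + (z + c) * (z + c)) ≡ + 2 * c * (N - (z + c)) - (z + c) * N
  identity = solve-∀
sumFree⇒bias {r} A sf 1≤s | inj₂ none =
  ⊥-elim (negative-absurd total identity)
  where
  F = fourier (ind ∘ A)
  N = card r
  s = ∣ A ∣
  G : F₂^ r → ℤ
  -- If no character satisfies the bound, the last factor is nonnegative everywhere. The third
  -- moment being zero, `∑ G` is (s² - 1) N s, whereas the trivial character alone contributes s² (s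
  -- N - 1), which is larger by s (N - s) > 0.
  G a = F a * F a * (F a * (N - s) + s * s - 1ℤ)
  positive : ∀ a → 0ℤ ≤ F a * (N - s) + s * s - 1ℤ
  positive a with fourier (ind ∘ A) a * (card r - ∣ A ∣) + ∣ A ∣ * ∣ A ∣ ≤? 0ℤ | none a
  ... | no ¬p | _ = subst (0ℤ ≤_) (shift (F a * (N - s) + s * s)) (slack< (≰⇒> ¬p))
    where
    shift : ∀ x → x - 0ℤ - 1ℤ ≡ x - 1ℤ
    shift = solve-∀
  ∑G : ∑ G ≡ (s * s - 1ℤ) * (N * s)
  ∑G = begin
    ∑ G
      ≡⟨ ∑-cong (λ a → expand (F a) N s) ⟩
    ∑ (λ a → (N - s) * (F a * (F a * F a)) + (s * s - 1ℤ) * (F a * F a))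
      ≡⟨ ∑-+ (λ a → (N - s) * (F a * (F a * F a))) (λ a → (s * s - 1ℤ) * (F a * F a)) ⟩
    ∑ (λ a → (N - s) * (F a * (F a * F a))) + ∑ (λ a → (s * s - 1ℤ) * (F a * F a))
      ≡⟨ cong₂ _+_ (∑-*ˡ (N - s) (λ a → F a * (F a * F a))) (∑-*ˡ (s * s - 1ℤ) (λ a → F a * F a)) ⟩
    (N - s) * ∑ (λ a → F a * (F a * F a)) + (s * s - 1ℤ) * ∑ (λ a → F a * F a)
      ≡⟨ cong₂ (λ x y → (N - s) * x + (s * s - 1ℤ) * y)
           (trans (∑-fourier³ (ind ∘ A)) (cong (N *_) triples))
           (trans (∑-fourier² (ind ∘ A)) (cong (N *_) (conv-ind-𝟎 A))) ⟩
    (N - s) * (N * 0ℤ) + (s * s - 1ℤ) * (N * s)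
      ≡⟨ simplify N s ⟩
    (s * s - 1ℤ) * (N * s) ∎
    where
    open ≡-Reasoning
    expand : ∀ x N s → x * x * (x * (N - s) + s * s - 1ℤ) ≡ (N - s) * (x * (x * x)) + (s * s - 1ℤ) * (x * x)
    expand = solve-∀
    simplify : ∀ N s → (N - s) * (N * 0ℤ) + (s * s - 1ℤ) * (N * s) ≡ (s * s - 1ℤ) * (N * s)
    simplify = solve-∀
    pointwise : ∀ x → ind (A x) * conv (ind ∘ A) (ind ∘ A) x ≡ 0ℤ
    pointwise x with A x in Ax
    ... | false = *-zeroˡ (conv (ind ∘ A) (ind ∘ A) x)
    ... | true  = trans (*-identityˡ _) (sumFree⇒conv≡0 A sf x Ax)
    triples : ∑ (λ x → ind (A x) * conv (ind ∘ A) (ind ∘ A) x) ≡ 0ℤ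
    triples = trans (∑-cong pointwise) (trans (∑-const {r} 0ℤ) (*-zeroˡ N))
  G𝟎≤ : G 𝟎 ≤ ∑ G
  G𝟎≤ = ∑-≥-𝟎 G (λ a _ → *-nonNeg (square-nonNeg (F a)) (positive a))
  -- A sum-free set omits the origin, so it is not the whole space.
  s<N : 0ℤ ≤ N - s - 1ℤ
  s<N = subst (0ℤ ≤_) (cong (_- 1ℤ) (∣∣-not A)) (slack outside)
    where
    𝟎∉A : A 𝟎 ≡ false
    𝟎∉A with A 𝟎 in A𝟎
    ... | false = refl
    ... | true  = ⊥-elim (sf 𝟎 𝟎 A𝟎 A𝟎 (trans (cong A (⊕-self 𝟎)) A𝟎))
    outside : 1ℤ ≤ ∣ not ∘ A ∣
    outside = subst (_≤ ∣ not ∘ A ∣) (cong (ind ∘ not) 𝟎∉A) (∑-≥-𝟎 (ind ∘ not ∘ A) (λ v _ → ind-≥0 (not (A v))))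
  total : 0ℤ ≤ ((∑ G - G 𝟎) + ((s - 1ℤ) * (N - s - 1ℤ) + ((s - 1ℤ) + (N - s - 1ℤ))))
  total = +-nonNeg (slack G𝟎≤)
            (+-nonNeg (*-nonNeg (slack 1≤s) s<N) (+-nonNeg (slack 1≤s) s<N))
  identity : (∑ G - G 𝟎) + ((s - 1ℤ) * (N - s - 1ℤ) + ((s - 1ℤ) + (N - s - 1ℤ))) ≡ - 1ℤ
  identity = trans (cong₂ (λ x y → (x - y) + ((s - 1ℤ) * (N - s - 1ℤ) + ((s - 1ℤ) + (N - s - 1ℤ)))) ∑G
               (cong (λ x → x * x * (x * (N - s) + s * s - 1ℤ)) (fourier-𝟎 (ind ∘ A)))) (ring N s)
    where
    ring : ∀ N s → ((s * s - 1ℤ) * (N * s) - s * s * (s * (N - s) + s * s - 1ℤ))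
             + ((s - 1ℤ) * (N - s - 1ℤ) + ((s - 1ℤ) + (N - s - 1ℤ))) ≡ - 1ℤ
    ring = solve-∀

-- Hyperplanes and parities of lists.

true≢false : true ≢ false
true≢false ()

not-true : ∀ {b} → not b ≡ true → b ≡ false
not-true {false} _ = refl

not-false : ∀ {b} → not b ≡ false → b ≡ true
not-false {true} _ = refl

∧-true : ∀ {a b} → a ∧ b ≡ true → a ≡ true × b ≡ true
∧-true {true} {true} _ = refl , refl

∣hyperplane∣ : (a w : F₂^ r) → a · w ≡ true → ∣ (a ·_) ∣ + ∣ (a ·_) ∣ ≡ card r
∣hyperplane∣ {r} a w aw = begin
  ∣ (a ·_) ∣ + ∣ (a ·_) ∣
    ≡⟨ cong (_+_ ∣ (a ·_) ∣) (sym (∑-shift (λ v → ind (a · v)) w)) ⟩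
  ∣ (a ·_) ∣ + ∑ (λ v → ind (a · (v ⊕ w)))
    ≡⟨ sym (∑-+ (λ v → ind (a · v)) (λ v → ind (a · (v ⊕ w)))) ⟩
  ∑ (λ v → ind (a · v) + ind (a · (v ⊕ w)))
    ≡⟨ ∑-cong (λ v → trans (cong (λ b → ind (a · v) + ind b) (trans (·-⊕ʳ a v w) (cong ((a · v) xor_) aw))) (complement (a · v))) ⟩
  ∑ {r} (λ _ → 1ℤ)
    ≡⟨ trans (∑-const {r} 1ℤ) (*-identityˡ (card r)) ⟩
  card r ∎
  where
  open ≡-Reasoning
  complement : ∀ b → ind b + ind (b xor true) ≡ 1ℤ
  complement false = refl
  complement true  = refl

inhabited : (P : F₂^ r → Bool) → 1ℤ ≤ ∣ P ∣ → ∃ λ v → P v ≡ true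
inhabited P 1≤P with search P
... | inj₁ w = w
... | inj₂ none = ⊥-elim (negative-absurd (slack 1≤P) (cong (_- 1ℤ) (∣∣-false {P = P} none)))

odd : ℕ → Bool
odd zero    = false
odd (suc n) = not (odd n)

lengthℤ : {X : Set} → List X → ℤ
lengthℤ []       = 0ℤ
lengthℤ (x ∷ xs) = 1ℤ + lengthℤ xs

lengthℤ≡ : {X : Set} (xs : List X) → lengthℤ xs ≡ + List.length xs
lengthℤ≡ []       = refl
lengthℤ≡ (x ∷ xs) = cong (_+_ 1ℤ) (lengthℤ≡ xs)

-- Twice the number of members on which the character of `b` is trivial.
agreement : F₂^ r → List (F₂^ r) → ℤ
agreement b []       = 0ℤ
agreement b (x ∷ xs) = (1ℤ + χ b x) + agreement b xs

1+χ-nonNeg : (b x : F₂^ r) → 0ℤ ≤ 1ℤ + χ b x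
1+χ-nonNeg b x with b · x
... | false = +≤+ z≤n
... | true  = +≤+ z≤n

agreement-nonNeg : (b : F₂^ r) (xs : List (F₂^ r)) → 0ℤ ≤ agreement b xs
agreement-nonNeg b []       = ≤-refl
agreement-nonNeg b (x ∷ xs) = +-nonNeg (1+χ-nonNeg b x) (agreement-nonNeg b xs)

-- A functional equal to 1 on every member takes on their sum the parity of their number.
agreement-≥2 : (b : F₂^ r) (xs : List (F₂^ r)) → + 2 ≤ agreement b xs ⊎ b · vsum xs ≡ odd (List.length xs)
agreement-≥2 b []       = inj₂ (·-𝟎ʳ b)
agreement-≥2 b (x ∷ xs) with b · x in bx
... | false = inj₁ (+-mono-≤ {+ 2} {+ 2} ≤-refl (agreement-nonNeg b xs))
... | true with agreement-≥2 b xs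
...   | inj₁ p = inj₁ (subst (+ 2 ≤_) (sym (+-identityˡ (agreement b xs))) p)
...   | inj₂ q = inj₂ (trans (·-⊕ʳ b x (vsum xs)) (cong₂ _xor_ bx q))

-- Sum-free sets cut by a hyperplane

module SumFreeSplit {r} (A : F₂^ r → Bool) (sf : SumFree A) (a : F₂^ r) where

  C Z : F₂^ r → Bool
  C = A ∣₁ a
  Z = A ∣₀ a

  c z N : ℤ
  c = ∣ C ∣
  z = ∣ Z ∣
  N = card r

  f : F₂^ r → ℤ
  f = ind ∘ C

  Z⇒A : ∀ {x} → Z x ≡ true → A x ≡ true
  Z⇒A {x} Zx = proj₁ (∧-true {A x} Zx)

  Z⇒· : ∀ {x} → Z x ≡ true → a · x ≡ false
  Z⇒· {x} Zx with A x | a · x | Zx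
  ... | true | false | _ = refl

  C⇒A : ∀ {x} → C x ≡ true → A x ≡ true
  C⇒A {x} Cx = proj₁ (∧-true {A x} Cx)

  C⇒· : ∀ {x} → C x ≡ true → a · x ≡ true
  C⇒· {x} Cx = proj₂ (∧-true {A x} Cx)

  C-apart : ∀ {x} → A x ≡ true → ∀ v → C v ≡ true → C (v ⊕ x) ≡ true → ⊥
  C-apart {x} Ax v Cv Cvx =
    sf v (v ⊕ x) (C⇒A Cv) (C⇒A Cvx) (trans (cong A (⊕-cancelˡ v x)) Ax)

  ·-shift : ∀ v {x} → a · x ≡ false → a · (v ⊕ x) ≡ a · v
  ·-shift v {x} ax = trans (·-⊕ʳ a v x) (trans (cong ((a · v) xor_) ax) (xor-identityʳ (a · v)))

  pair : F₂^ r → F₂^ r → Bool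
  pair u v = C v ∨ C (v ⊕ u)

  ind-pair : ∀ {u} → A u ≡ true → ∀ v → ind (pair u v) ≡ f v + f (v ⊕ u)
  ind-pair {u} Au v with C v in Cv | C (v ⊕ u) in Cvu
  ... | false | false = refl
  ... | false | true  = refl
  ... | true  | false = refl
  ... | true  | true  = ⊥-elim (C-apart Au v Cv Cvu)

  pair⇒· : ∀ {u} → a · u ≡ false → ∀ v → pair u v ≡ true → a · v ≡ true
  pair⇒· {u} au v p with C v in Cv
  ... | true  = C⇒· Cv
  ... | false = trans (sym (·-shift v au)) (C⇒· p)

  ∣pair∣ : ∀ {u} → A u ≡ true → ∑ (λ v → f v + f (v ⊕ u)) ≡ c + c
  ∣pair∣ {u} Au = trans (∑-+ f (λ v → f (v ⊕ u))) (cong (_+_ c) (∑-shift f u))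

  -- If `a` vanished at `x`, then `C` and its translate by `x` would be disjoint subsets of a set of
  -- N/2 points.
  majority : N < + 4 * c → ∀ x → A x ≡ true → a · x ≡ true
  majority N<4c x Ax with a · x in ax
  ... | true  = refl
  ... | false = ⊥-elim (negative-absurd
          (+-nonNeg (+-nonNeg (slack 2c≤h) (slack 2c≤h)) (slack< N<4c))
          (trans (cong₂ (λ p q → ((h - p) + (h - p)) + (+ 4 * c - q - 1ℤ)) (∣pair∣ Ax) (sym (∣hyperplane∣ a w aw)))
                 (arith h c)))
    where
    h = ∣ (a ·_) ∣
    1≤c : 1ℤ ≤ c
    1≤c = ≮⇒≥ λ c<1 → negative-absurd
      (+-nonNeg (+-nonNeg (+-nonNeg (slack< N<4c) (slack< c<1)) (+-nonNeg (slack< c<1) (slack< c<1))) (+-nonNeg (slack< c<1) (0≤card r)))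
      (arith₁ N c)
      where
      arith₁ : ∀ N c → (+ 4 * c - N - 1ℤ + (1ℤ - c - 1ℤ) + ((1ℤ - c - 1ℤ) + (1ℤ - c - 1ℤ)) + ((1ℤ - c - 1ℤ) + N)) ≡ - 1ℤ
      arith₁ = solve-∀
    w = proj₁ (inhabited C 1≤c)
    aw : a · w ≡ true
    aw = C⇒· (proj₂ (inhabited C 1≤c))
    2c≤h : ∑ (λ v → f v + f (v ⊕ x)) ≤ h
    2c≤h = ∑-mono λ v → subst (_≤ ind (a · v)) (ind-pair Ax v) (ind-mono (pair⇒· ax v))
    arith : ∀ h c → (h - (c + c)) + (h - (c + c)) + (+ 4 * c - (h + h) - 1ℤ) ≡ - 1ℤ
    arith = solve-∀

  conv-Z : ∀ {x} → Z x ≡ true → conv f f x ≡ 0ℤ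
  conv-Z {x} Zx = trans (∑-cong pointwise) (trans (∑-const {r} 0ℤ) (*-zeroˡ N))
    where
    pointwise : ∀ v → f v * f (v ⊕ x) ≡ 0ℤ
    pointwise v with C v in Cv | C (v ⊕ x) in Cvx
    ... | false | _     = refl
    ... | true  | false = refl
    ... | true  | true  = ⊥-elim (C-apart (Z⇒A Zx) v Cv Cvx)

  -- The union of `C` and its translate by `u`, and the translate of that union by `x`, both have 2c
  -- points among the N/2 off the hyperplane, so they share at least 4c - N/2. Expanding the
  -- intersection into four correlations, two vanish by `conv-Z` and the other two equal
  -- `conv f f (x ⊕ u)`.
  conv-ZZ : ∀ w → a · w ≡ true → ∀ {x u} → Z x ≡ true → Z u ≡ true →
    + 8 * c - N ≤ + 4 * conv f f (x ⊕ u)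
  conv-ZZ w aw {x} {u} Zx Zu = ≤-by (+-nonNeg bound bound) (trans
      (cong₂ (λ p q → (p - q) + (p - q)) rhs lhs)
      (trans (arith c h (conv f f (x ⊕ u))) (cong (λ n → + 4 * conv f f (x ⊕ u) - (+ 8 * c - n)) (∣hyperplane∣ a w aw))))
    where
    h = ∣ (a ·_) ∣
    g : F₂^ r → ℤ
    g v = f v + f (v ⊕ u)
    bound : 0ℤ ≤ ∑ (λ v → g v * g (v ⊕ x)) - ∑ (λ v → (g v + g (v ⊕ x)) - ind (a · v))
    bound = slack (∑-mono λ v → subst₂ (λ p q → (p + q) - ind (a · v) ≤ p * q)
              (ind-pair (Z⇒A Zu) v) (ind-pair (Z⇒A Zu) (v ⊕ x))
              (pointwise (pair u v) (pair u (v ⊕ x)) (a · v) (pair⇒· (Z⇒· Zu) v)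
                 (λ p → trans (sym (·-shift v (Z⇒· Zx))) (pair⇒· (Z⇒· Zu) (v ⊕ x) p))))
      where
      pointwise : ∀ p q b → (p ≡ true → b ≡ true) → (q ≡ true → b ≡ true) →
        (ind p + ind q) - ind b ≤ ind p * ind q
      pointwise false false false _ _ = +≤+ z≤n
      pointwise false false true  _ _ = Data.Integer.-≤+
      pointwise false true  true  _ _ = +≤+ z≤n
      pointwise true  false true  _ _ = +≤+ z≤n
      pointwise true  true  true  _ _ = ≤-refl
      pointwise false true  false _ q with q refl
      ... | ()
      pointwise true  _     false p _ with p refl
      ... | ()
    lhs : ∑ (λ v → (g v + g (v ⊕ x)) - ind (a · v)) ≡ ((c + c) + (c + c)) - h
    lhs = trans (∑-- (λ v → g v + g (v ⊕ x)) (λ v → ind (a · v)))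
            (cong (_- h) (trans (∑-+ g (λ v → g (v ⊕ x)))
              (cong₂ _+_ (∣pair∣ (Z⇒A Zu)) (trans (∑-shift g x) (∣pair∣ (Z⇒A Zu))))))
    shifted : ∀ p q → ∑ (λ v → f (v ⊕ p) * f (v ⊕ q)) ≡ conv f f (p ⊕ q)
    shifted p q = trans
      (∑-cong λ v → cong (λ t → f (v ⊕ p) * f t)
        (xor-solve (v ∷ p ∷ q ∷ []) (var zero :⊕ var (suc (suc zero)))
          ((var zero :⊕ var (suc zero)) :⊕ (var (suc zero) :⊕ var (suc (suc zero)))) refl))
      (∑-shift (λ v → f v * f (v ⊕ (p ⊕ q))) p)
    expand : ∀ p q s t → (p + q) * (s + t) ≡ (p * s + p * t) + (q * s + q * t)
    expand = solve-∀
    rhs : ∑ (λ v → g v * g (v ⊕ x)) ≡ conv f f (x ⊕ u) + conv f f (x ⊕ u)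
    rhs = begin
      ∑ (λ v → g v * g (v ⊕ x))
        ≡⟨ ∑-cong (λ v → expand (f v) (f (v ⊕ u)) (f (v ⊕ x)) (f ((v ⊕ x) ⊕ u))) ⟩
      ∑ (λ v → (f v * f (v ⊕ x) + f v * f ((v ⊕ x) ⊕ u)) + (f (v ⊕ u) * f (v ⊕ x) + f (v ⊕ u) * f ((v ⊕ x) ⊕ u)))
        ≡⟨ trans (∑-+ (λ v → f v * f (v ⊕ x) + f v * f ((v ⊕ x) ⊕ u)) (λ v → f (v ⊕ u) * f (v ⊕ x) + f (v ⊕ u) * f ((v ⊕ x) ⊕ u)))
             (cong₂ _+_ (∑-+ (λ v → f v * f (v ⊕ x)) (λ v → f v * f ((v ⊕ x) ⊕ u)))
                        (∑-+ (λ v → f (v ⊕ u) * f (v ⊕ x)) (λ v → f (v ⊕ u) * f ((v ⊕ x) ⊕ u)))) ⟩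
      (∑ (λ v → f v * f (v ⊕ x)) + ∑ (λ v → f v * f ((v ⊕ x) ⊕ u)))
        + (∑ (λ v → f (v ⊕ u) * f (v ⊕ x)) + ∑ (λ v → f (v ⊕ u) * f ((v ⊕ x) ⊕ u)))
        ≡⟨ cong₂ _+_
             (cong₂ _+_ (conv-Z Zx) (∑-cong λ v → cong (λ t → f v * f t) (⊕-assoc v x u)))
             (cong₂ _+_ (trans (shifted u x) (cong (conv f f) (⊕-comm u x)))
                (trans (trans (∑-cong λ v → cong (λ t → f (v ⊕ u) * f t) (⊕-assoc v x u)) (shifted u (x ⊕ u)))
                  (trans (cong (conv f f) (trans (cong (u ⊕_) (⊕-comm x u)) (⊕-cancelˡ u x))) (conv-Z Zx)))) ⟩
      (0ℤ + conv f f (x ⊕ u)) + (conv f f (x ⊕ u) + 0ℤ)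
        ≡⟨ cong₂ _+_ (+-identityˡ (conv f f (x ⊕ u))) (+-identityʳ (conv f f (x ⊕ u))) ⟩
      conv f f (x ⊕ u) + conv f f (x ⊕ u) ∎
      where open ≡-Reasoning
    arith : ∀ c h t → ((t + t) - (((c + c) + (c + c)) - h)) + ((t + t) - (((c + c) + (c + c)) - h))
              ≡ + 4 * t - (+ 8 * c - (h + h))
    arith = solve-∀

  -- Twice the squared coefficient of `C` at the characters with `b · u ≡ true`, and zero at the
  -- others; the form `1ℤ - χ b u` makes its moments differences of correlations.
  weight : F₂^ r → F₂^ r → ℤ
  weight u b = fourier f b * fourier f b * (1ℤ - χ b u)

  weight-nonNeg : ∀ u b → 0ℤ ≤ weight u b
  weight-nonNeg u b = *-nonNeg (square-nonNeg (fourier f b)) (lemma (b · u))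
    where
    lemma : ∀ t → 0ℤ ≤ 1ℤ - sgn t
    lemma false = +≤+ z≤n
    lemma true  = +≤+ z≤n

  ∑-weight-χ : ∀ u x → ∑ (λ b → weight u b * χ b x) ≡ N * (conv f f x - conv f f (x ⊕ u))
  ∑-weight-χ u x = begin
    ∑ (λ b → weight u b * χ b x)
      ≡⟨ ∑-cong (λ b → trans (expand (fourier f b * fourier f b) (χ b u) (χ b x))
           (cong (λ t → fourier f b * fourier f b * χ b x - fourier f b * fourier f b * t) (sym (χ-⊕ b x u)))) ⟩
    ∑ (λ b → fourier f b * fourier f b * χ b x - fourier f b * fourier f b * χ b (x ⊕ u))
      ≡⟨ ∑-- (λ b → fourier f b * fourier f b * χ b x) (λ b → fourier f b * fourier f b * χ b (x ⊕ u)) ⟩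
    ∑ (λ b → fourier f b * fourier f b * χ b x) - ∑ (λ b → fourier f b * fourier f b * χ b (x ⊕ u))
      ≡⟨ cong₂ _-_ (∑-fourier²-χ f x) (∑-fourier²-χ f (x ⊕ u)) ⟩
    N * conv f f x - N * conv f f (x ⊕ u)
      ≡⟨ factor N (conv f f x) (conv f f (x ⊕ u)) ⟩
    N * (conv f f x - conv f f (x ⊕ u)) ∎
    where
    open ≡-Reasoning
    expand : ∀ F s t → F * (1ℤ - s) * t ≡ F * t - F * (t * s)
    expand = solve-∀
    factor : ∀ N s t → N * s - N * t ≡ N * (s - t)
    factor = solve-∀

  ∑-weight : ∀ {u} → Z u ≡ true → ∑ (weight u) ≡ N * c
  ∑-weight {u} Zu = begin
    ∑ (weight u)                                  ≡⟨ ∑-cong (λ b → sym (trans (cong (λ t → weight u b * sgn t) (·-𝟎ʳ b)) (*-identityʳ (weight u b)))) ⟩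
    ∑ (λ b → weight u b * χ b 𝟎)                  ≡⟨ ∑-weight-χ u 𝟎 ⟩
    N * (conv f f 𝟎 - conv f f (𝟎 ⊕ u))           ≡⟨ cong₂ (λ s t → N * (s - t)) (conv-ind-𝟎 C) (trans (cong (conv f f) (⊕-identityˡ u)) (conv-Z Zu)) ⟩
    N * (c - 0ℤ)                                  ≡⟨ cong (N *_) (+-identityʳ c) ⟩
    N * c                                         ∎
    where open ≡-Reasoning

  -- Each member `x` contributes N (c - conv f f (x ⊕ u)), since the correlation at `x` vanishes,
  -- and by `conv-ZZ` four times this is at most N (N - 4c).
  ∑-weight-agreement : ∀ w → a · w ≡ true → ∀ {u} → Z u ≡ true → ∀ xs → All (λ x → Z x ≡ true) xs →
    + 4 * ∑ (λ b → weight u b * agreement b xs) ≤ lengthℤ xs * (N * (N - + 4 * c))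
  ∑-weight-agreement w aw {u} Zu [] [] = ≤-reflexive (begin
    + 4 * ∑ (λ b → weight u b * 0ℤ) ≡⟨ cong (+ 4 *_) (trans (∑-cong (λ b → *-zeroʳ (weight u b))) (trans (∑-const {r} 0ℤ) (*-zeroˡ N))) ⟩
    0ℤ                              ≡⟨ sym (*-zeroˡ (N * (N - + 4 * c))) ⟩
    0ℤ * (N * (N - + 4 * c))        ∎)
    where open ≡-Reasoning
  ∑-weight-agreement w aw {u} Zu (x ∷ xs) (Zx ∷ Zxs) =
    subst (λ t → + 4 * t ≤ lengthℤ (x ∷ xs) * (N * (N - + 4 * c))) (sym split)
      (combine N c (conv f f (x ⊕ u)) (∑ (λ b → weight u b * agreement b xs)) (lengthℤ xs)
        (0≤card r) (conv-ZZ w aw Zx Zu) (∑-weight-agreement w aw Zu xs Zxs))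
    where
    open ≡-Reasoning
    distribute : ∀ W s t → W * ((1ℤ + s) + t) ≡ (W + W * s) + W * t
    distribute = solve-∀
    split : ∑ (λ b → weight u b * agreement b (x ∷ xs))
              ≡ (N * c + N * (0ℤ - conv f f (x ⊕ u))) + ∑ (λ b → weight u b * agreement b xs)
    split = begin
      ∑ (λ b → weight u b * ((1ℤ + χ b x) + agreement b xs))
        ≡⟨ ∑-cong (λ b → distribute (weight u b) (χ b x) (agreement b xs)) ⟩
      ∑ (λ b → (weight u b + weight u b * χ b x) + weight u b * agreement b xs)
        ≡⟨ trans (∑-+ (λ b → weight u b + weight u b * χ b x) (λ b → weight u b * agreement b xs))
             (cong (_+ ∑ (λ b → weight u b * agreement b xs)) (∑-+ (weight u) (λ b → weight u b * χ b x))) ⟩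
      (∑ (weight u) + ∑ (λ b → weight u b * χ b x)) + ∑ (λ b → weight u b * agreement b xs)
        ≡⟨ cong (_+ ∑ (λ b → weight u b * agreement b xs)) (cong₂ _+_ (∑-weight Zu)
             (trans (∑-weight-χ u x) (cong (λ t → N * (t - conv f f (x ⊕ u))) (conv-Z Zx)))) ⟩
      (N * c + N * (0ℤ - conv f f (x ⊕ u))) + ∑ (λ b → weight u b * agreement b xs) ∎
    combine : ∀ N c t S l → 0ℤ ≤ N → + 8 * c - N ≤ + 4 * t → + 4 * S ≤ l * (N * (N - + 4 * c)) →
      + 4 * ((N * c + N * (0ℤ - t)) + S) ≤ (1ℤ + l) * (N * (N - + 4 * c))
    combine N c t S l 0≤N p q = ≤-by (+-nonNeg (*-nonNeg 0≤N (slack p)) (slack q)) (arith N c t S l)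
      where
      arith : ∀ N c t S l → N * (+ 4 * t - (+ 8 * c - N)) + (l * (N * (N - + 4 * c)) - + 4 * S)
                ≡ (1ℤ + l) * (N * (N - + 4 * c)) - + 4 * ((N * c + N * (0ℤ - t)) + S)
      arith = solve-∀

  -- Weighting the characters b with b · u = 1 by the squared Fourier transform of C: each of them
  -- is trivial on some member of the circuit u ∷ xs, while most of the weight sits on
  -- characters that are nontrivial on any prescribed member.
  circuit-bound : ∀ w → a · w ≡ true → ∀ {u} → Z u ≡ true → ∀ xs → All (λ x → Z x ≡ true) xs →
    odd (List.length xs) ≡ false → vsum xs ≡ u → + 8 * c ≤ lengthℤ xs * (N - + 4 * c)
  circuit-bound w aw {u} Zu xs Zxs even sum =
    *-cancelˡ-≤-pos (+ 8 * c) (lengthℤ xs * (N - + 4 * c)) N {{Data.Integer.positive (<-≤-trans (Data.Integer.+<+ (s≤s z≤n)) (1≤card r))}}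
      (subst₂ _≤_ lhs (rhs (lengthℤ xs) N (N - + 4 * c))
        (≤-trans (*-monoˡ-≤-nonNeg (+ 4) (∑-mono pointwise)) (∑-weight-agreement w aw Zu xs Zxs)))
    where
    lhs : + 4 * ∑ (λ b → weight u b * + 2) ≡ N * (+ 8 * c)
    lhs = trans (cong (+ 4 *_) (trans (∑-*ʳ (+ 2) (weight u)) (cong (_* + 2) (∑-weight Zu)))) (arith N c)
      where
      arith : ∀ N c → + 4 * (N * c * + 2) ≡ N * (+ 8 * c)
      arith = solve-∀
    rhs : ∀ l N e → l * (N * e) ≡ N * (l * e)
    rhs = solve-∀
    pointwise : ∀ b → weight u b * + 2 ≤ weight u b * agreement b xs
    pointwise b with agreement-≥2 b xs
    ... | inj₁ p = ≤-by (*-nonNeg (weight-nonNeg u b) (slack p)) (arith (weight u b) (agreement b xs))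
      where
      arith : ∀ W L → W * (L - + 2) ≡ W * L - W * + 2
      arith = solve-∀
    -- Here `b` is 1 on all of the evenly many members, hence 0 on their sum `u`, where the weight
    -- vanishes.
    ... | inj₂ q = ≤-reflexive (trans (cong (_* + 2) vanish) (trans (*-zeroˡ (+ 2)) (sym (trans (cong (_* agreement b xs) vanish) (*-zeroˡ (agreement b xs))))))
      where
      vanish : weight u b ≡ 0ℤ
      vanish = trans (cong (λ t → fourier f b * fourier f b * (1ℤ - sgn t)) (trans (cong (b ·_) (sym sum)) (trans q even)))
                     (*-zeroʳ (fourier f b * fourier f b))

-- Duality and packing by codes.

nondegenerate : (v : F₂^ r) → (∀ a → a · v ≡ false) → v ≡ 𝟎
nondegenerate []      p = refl
nondegenerate (x ∷ v) p = cong₂ _∷_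
  (trans (sym (trans (cong (x xor_) (·-𝟎ˡ v)) (xor-identityʳ x))) (p (true ∷ 𝟎)))
  (nondegenerate v (λ a → p (false ∷ a)))

separated⇒≢𝟎 : {a v : F₂^ r} → a · v ≡ true → v ≢ 𝟎
separated⇒≢𝟎 {a = a} av refl = true≢false (trans (sym av) (·-𝟎ʳ a))

apply-map : (A : Matrix m n) (B : Matrix n r) (x : F₂^ r) →
  apply (Vec.map (apply A) B) x ≡ apply A (apply B x)
apply-map A []      []          = sym (apply-𝟎 A)
apply-map A (b ∷ B) (false ∷ x) = apply-map A B x
apply-map A (b ∷ B) (true ∷ x)  =
  trans (cong (apply A b ⊕_) (apply-map A B x)) (sym (apply-⊕ A b (apply B x)))

-- The translates of Z by the span of gs are pairwise disjoint.
packing : (Z : F₂^ r → Bool) (gs : Matrix r n) →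
  (∀ b → b ≢ 𝟎 → ∀ u v → Z u ≡ true → Z v ≡ true → apply gs b ≢ u ⊕ v) →
  card n * ∣ Z ∣ ≤ card r
packing {r} {n} Z gs apart = subst₂ _≤_ total (trans (∑-const {r} 1ℤ) (*-identityˡ (card r)))
  (∑-mono λ v → ∣∣-unique (λ b → Z (v ⊕ apply gs b)) (unique v))
  where
  unique : ∀ v b b′ → Z (v ⊕ apply gs b) ≡ true → Z (v ⊕ apply gs b′) ≡ true → b ≡ b′
  -- Two translates meeting at `v` make `apply gs (b ⊕ b′)` a sum of two members of `Z`. Whether `b`
  -- and `b′` differ is decided by looking for a functional that tells them apart.
  unique v b b′ Zb Zb′ with search (unit-difference b b′)
    where
    unit-difference : F₂^ n → F₂^ n → F₂^ n → Bool
    unit-difference b b′ a = a · (b ⊕ b′)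
  ... | inj₁ (a , ab) = ⊥-elim (apart (b ⊕ b′) (λ e → true≢false (trans (sym ab) (trans (cong (a ·_) e) (·-𝟎ʳ a)))) _ _ Zb Zb′
          (trans (apply-⊕ gs b b′) (xor-solve (v ∷ apply gs b ∷ apply gs b′ ∷ []) (# 1 :⊕ # 2)
            ((# 0 :⊕ # 1) :⊕ (# 0 :⊕ # 2)) refl)))
  ... | inj₂ none = ⊕≡𝟎⇒≡ b b′ (nondegenerate (b ⊕ b′) none)
  total : ∑ (λ v → ∑ (λ b → ind (Z (v ⊕ apply gs b)))) ≡ card n * ∣ Z ∣
  total = trans (∑-swap (λ v b → ind (Z (v ⊕ apply gs b))))
    (trans (∑-cong (λ b → ∑-shift (ind ∘ Z) (apply gs b)))
      (trans (∑-const {n} ∣ Z ∣) (*-comm ∣ Z ∣ (card n))))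

-- A circuit of length circuitLength j = 2k + 1, where k = 3 + j, with coBound j = 2k - 3.
circuitLength coBound : ℕ → ℕ
circuitLength zero    = 7
circuitLength (suc j) = 2 ℕ.+ circuitLength j
coBound zero    = 3
coBound (suc j) = 2 ℕ.+ coBound j

vecSum : Vec (F₂^ r) n → F₂^ r
vecSum []       = 𝟎
vecSum (x ∷ xs) = x ⊕ vecSum xs

-- Read inside a circuit xs with sum zero, Code says that the generators span a code of even words
-- of weight at least 4: each nonzero combination is a sum over an even set
-- of members whose complement, listed by the witness, has at most 2k - 3 elements.
Code : (Z : F₂^ r → Bool) (j : ℕ) → Vec (F₂^ r) (circuitLength j) → Matrix r (3 ℕ.+ j) → Set
Code Z j xs gs = ∀ b → b ≢ 𝟎 → ∃ λ ys → All (λ y → Z y ≡ true) ys × odd (List.length ys) ≡ true ×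
  List.length ys ℕ.≤ coBound j × apply gs b ⊕ vsum ys ≡ vecSum xs

vecSum-toList : (xs : Vec (F₂^ r) n) → vsum (Vec.toList xs) ≡ vecSum xs
vecSum-toList []       = refl
vecSum-toList (x ∷ xs) = cong (x ⊕_) (vecSum-toList xs)

circuitLength≡4+coBound : ∀ j → circuitLength j ≡ 4 ℕ.+ coBound j
circuitLength≡4+coBound zero    = refl
circuitLength≡4+coBound (suc j) = cong (2 ℕ.+_) (circuitLength≡4+coBound j)

odd-coBound : ∀ j → odd (coBound j) ≡ true
odd-coBound zero    = refl
odd-coBound (suc j) = trans (not-involutive _) (odd-coBound j)

length-toList : {X : Set} (xs : Vec X n) → List.length (Vec.toList xs) ≡ n
length-toList []       = refl
length-toList (x ∷ xs) = cong suc (length-toList xs)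

All-toList : {Z : F₂^ r → Bool} {xs : Vec (F₂^ r) n} →
  VecAll.All (λ x → Z x ≡ true) xs → All (λ x → Z x ≡ true) (Vec.toList xs)
All-toList []       = []
All-toList (p ∷ ps) = p ∷ All-toList ps

-- Dimension 3 + j at length 7 + 2j: each step adds two coordinates and one generator to the code of
-- the shorter circuit.
code : (Z : F₂^ r → Bool) (j : ℕ) (xs : Vec (F₂^ r) (circuitLength j)) →
  VecAll.All (λ x → Z x ≡ true) xs → ∃ (Code Z j xs)
-- The [7,3] simplex code: complements of nonzero words are the lines of the Fano plane.
code {r} Z zero xs@(x₁ ∷ x₂ ∷ x₃ ∷ x₄ ∷ x₅ ∷ x₆ ∷ x₇ ∷ []) (p₁ ∷ p₂ ∷ p₃ ∷ p₄ ∷ p₅ ∷ p₆ ∷ p₇ ∷ []) =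
  Vec.map (apply xs) words , λ where
    (false ∷ false ∷ false ∷ []) b≢0 → ⊥-elim (b≢0 refl)
    b@(true  ∷ false ∷ false ∷ []) _ → x₁ ∷ x₂ ∷ x₃ ∷ [] , p₁ ∷ p₂ ∷ p₃ ∷ [] , refl , ℕ.≤-refl ,
      line b (true ∷ true ∷ true ∷ false ∷ false ∷ false ∷ false ∷ []) refl
    b@(false ∷ true  ∷ false ∷ []) _ → x₁ ∷ x₄ ∷ x₅ ∷ [] , p₁ ∷ p₄ ∷ p₅ ∷ [] , refl , ℕ.≤-refl ,
      line b (true ∷ false ∷ false ∷ true ∷ true ∷ false ∷ false ∷ []) refl
    b@(true  ∷ true  ∷ false ∷ []) _ → x₁ ∷ x₆ ∷ x₇ ∷ [] , p₁ ∷ p₆ ∷ p₇ ∷ [] , refl , ℕ.≤-refl ,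
      line b (true ∷ false ∷ false ∷ false ∷ false ∷ true ∷ true ∷ []) refl
    b@(false ∷ false ∷ true  ∷ []) _ → x₂ ∷ x₄ ∷ x₆ ∷ [] , p₂ ∷ p₄ ∷ p₆ ∷ [] , refl , ℕ.≤-refl ,
      line b (false ∷ true ∷ false ∷ true ∷ false ∷ true ∷ false ∷ []) refl
    b@(true  ∷ false ∷ true  ∷ []) _ → x₂ ∷ x₅ ∷ x₇ ∷ [] , p₂ ∷ p₅ ∷ p₇ ∷ [] , refl , ℕ.≤-refl ,
      line b (false ∷ true ∷ false ∷ false ∷ true ∷ false ∷ true ∷ []) refl
    b@(false ∷ true  ∷ true  ∷ []) _ → x₃ ∷ x₄ ∷ x₇ ∷ [] , p₃ ∷ p₄ ∷ p₇ ∷ [] , refl , ℕ.≤-refl ,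
      line b (false ∷ false ∷ true ∷ true ∷ false ∷ false ∷ true ∷ []) refl
    b@(true  ∷ true  ∷ true  ∷ []) _ → x₃ ∷ x₅ ∷ x₆ ∷ [] , p₃ ∷ p₅ ∷ p₆ ∷ [] , refl , ℕ.≤-refl ,
      line b (false ∷ false ∷ true ∷ false ∷ true ∷ true ∷ false ∷ []) refl
  where
  words : Matrix 7 3
  words = (false ∷ false ∷ false ∷ true ∷ true ∷ true ∷ true ∷ [])
        ∷ (false ∷ true ∷ true ∷ false ∷ false ∷ true ∷ true ∷ [])
        ∷ (true ∷ false ∷ true ∷ false ∷ true ∷ false ∷ true ∷ []) ∷ []
  -- A codeword and its complementary line add up to the all-ones word, which `apply xs` sends to
  -- `vecSum xs`.
  line : ∀ b l → apply words b ⊕ l ≡ Vec.replicate 7 true →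
    apply (Vec.map (apply xs) words) b ⊕ apply xs l ≡ vecSum xs
  line b l e = trans (cong (_⊕ apply xs l) (apply-map xs words b))
    (trans (sym (apply-⊕ xs (apply words b) l)) (cong (apply xs) e))
code {r} Z (suc j) (x ∷ y ∷ xs) (px ∷ py ∷ ps) with code Z j xs ps
... | gs , spec = extend j xs ps gs spec
  where
  -- The new word has weight 2 on the new coordinates and differs from each old word, of
  -- weight 0 or at least 4, in at least 2 old ones.
  extend : ∀ j (xs : Vec (F₂^ r) (circuitLength j)) → VecAll.All (λ x → Z x ≡ true) xs →
    (gs : Matrix r (3 ℕ.+ j)) → Code Z j xs gs → ∃ (Code Z (suc j) (x ∷ y ∷ xs))
  extend j xs ps gs spec with circuitLength j | circuitLength≡4+coBound j | xs | ps | spec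
  ... | _ | refl | p ∷ q ∷ xs | pp ∷ pq ∷ ps | spec =
    ((x ⊕ y) ⊕ (p ⊕ q)) ∷ gs , λ where
      (false ∷ b) b≢0 →
        let ys , Zys , oddys , short , sum = spec b (λ { refl → b≢0 refl })
        in x ∷ y ∷ ys , px ∷ py ∷ Zys , trans (not-involutive _) oddys , s≤s (s≤s short) ,
           trans (xor-solve (apply gs b ∷ x ∷ y ∷ vsum ys ∷ [])
                    (# 0 :⊕ (# 1 :⊕ (# 2 :⊕ # 3)))
                    (# 1 :⊕ (# 2 :⊕ (# 0 :⊕ # 3))) refl)
                 (cong (λ s → x ⊕ (y ⊕ s)) sum)
      (true ∷ b) _ → new b (search (λ a → a · b))
    where
    new : ∀ b → (∃ λ a → a · b ≡ true) ⊎ (∀ a → a · b ≡ false) →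
      ∃ λ ys → All (λ y → Z y ≡ true) ys × odd (List.length ys) ≡ true ×
      List.length ys ℕ.≤ coBound (suc j) × (((x ⊕ y) ⊕ (p ⊕ q)) ⊕ apply gs b) ⊕ vsum ys ≡ x ⊕ (y ⊕ (p ⊕ (q ⊕ vecSum xs)))
    new b (inj₁ (a , ab)) =
      let ys , Zys , oddys , short , sum = spec b (λ e → true≢false (trans (sym ab) (trans (cong (a ·_) e) (·-𝟎ʳ a))))
      -- Adding the new word removes `x` and `y` from the complement and toggles `p` and `q`. If one
      -- of these already occurs in `ys`, the repetition cancels in the sum and is harmless, as only
      -- sum, parity and a length bound are recorded.
      in p ∷ q ∷ ys , pp ∷ pq ∷ Zys , trans (not-involutive _) oddys , s≤s (s≤s short) ,
         trans (xor-solve (apply gs b ∷ x ∷ y ∷ p ∷ q ∷ vsum ys ∷ [])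
                  (((# 1 :⊕ # 2) :⊕ (# 3 :⊕ # 4) :⊕ # 0) :⊕ (# 3 :⊕ (# 4 :⊕ # 5)))
                  (# 1 :⊕ (# 2 :⊕ (# 0 :⊕ # 5))) refl)
               (cong (λ s → x ⊕ (y ⊕ s)) sum)
    new b (inj₂ none) =
      -- The new word by itself, whose complement is everything except `x`, `y`, `p`, `q`.
      Vec.toList xs , All-toList ps ,
      trans (cong odd (length-toList xs)) (trans (not-involutive _) (odd-coBound j)) ,
      ℕ.≤-reflexive (length-toList xs) ,
      trans (cong₂ (λ s t → (((x ⊕ y) ⊕ (p ⊕ q)) ⊕ s) ⊕ t)
              (trans (cong (apply gs) (nondegenerate b none)) (apply-𝟎 gs)) (vecSum-toList xs))
        (trans (cong (_⊕ vecSum xs) (⊕-identityʳ ((x ⊕ y) ⊕ (p ⊕ q))))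
          (xor-solve (x ∷ y ∷ p ∷ q ∷ vecSum xs ∷ [])
            ((# 0 :⊕ # 1) :⊕ (# 2 :⊕ # 3) :⊕ # 4)
            (# 0 :⊕ (# 1 :⊕ (# 2 :⊕ (# 3 :⊕ # 4)))) refl))

-- Duality between odd circuits and functionals equal to 1.

separate : {X : Set} {Q : X → Set} (g : X → F₂^ m) (xs : List X) → All Q xs → (e : F₂^ m) →
  (∃ λ ys → All Q ys × vsum (List.map g ys) ≡ e) ⊎
  (∃ λ φ → φ · e ≡ true × All (λ x → φ · g x ≡ false) xs)
separate g [] [] e with search (λ φ → φ · e)
... | inj₁ (φ , φe) = inj₂ (φ , φe , [])
... | inj₂ none     = inj₁ ([] , [] , sym (nondegenerate e none))
separate g (x ∷ xs) (Qx ∷ Qxs) e with separate g xs Qxs e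
... | inj₁ spanned = inj₁ spanned
... | inj₂ (φ , φe , φxs) with φ · g x in φx
...   | false = inj₂ (φ , φe , φx ∷ φxs)
-- As `φ` fails at `x`, ask again for the target `g x ⊕ e`: a representation of it together with `x`
-- represents `e`, and otherwise either the second functional `ψ` or `φ ⊕ ψ` is 0 at `g x` and 1 at
-- `e`.
...   | true with separate g xs Qxs (g x ⊕ e)
...     | inj₁ (ys , Qys , sum) = inj₁ (x ∷ ys , Qx ∷ Qys , trans (cong (g x ⊕_) sum) (⊕-cancelˡ (g x) e))
...     | inj₂ (ψ , ψxe , ψxs) with ψ · g x in ψx | ψ · e in ψe | trans (sym (·-⊕ʳ ψ (g x) e)) ψxe
...       | false | true  | _ = inj₂ (ψ , ψe , ψx ∷ ψxs)
...       | true  | false | _ = inj₂ (φ ⊕ ψ , trans (·-⊕ˡ φ ψ e) (cong₂ _xor_ φe ψe) ,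
                                  trans (·-⊕ˡ φ ψ (g x)) (cong₂ _xor_ φx ψx) ∷ All.zipWith both (φxs , ψxs))
  where
  both : ∀ {y} → φ · g y ≡ false × ψ · g y ≡ false → (φ ⊕ ψ) · g y ≡ false
  both (p , q) = trans (·-⊕ˡ φ ψ _) (cong₂ _xor_ p q)

∈-allVecs : (v : F₂^ r) → v ∈ allVecs r
∈-allVecs []          = here refl
∈-allVecs (false ∷ v) = ∈-++⁺ˡ (∈-map⁺ (false ∷_) (∈-allVecs v))
∈-allVecs (true ∷ v)  = ∈-++⁺ʳ (List.map (false ∷_) (allVecs _)) (∈-map⁺ (true ∷_) (∈-allVecs v))

vsum-true∷ : (ys : List (F₂^ r)) → vsum (List.map (true ∷_) ys) ≡ odd (List.length ys) ∷ vsum ys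
vsum-true∷ []       = refl
vsum-true∷ (y ∷ ys) = cong ((true ∷ y) ⊕_) (vsum-true∷ ys)

-- Prefix every vector with a coordinate 1. Representing (1, 0) by such vectors is exactly an odd
-- circuit; otherwise a separating functional has leading coefficient 1, and its remaining
-- coefficients form `ψ`.
bipartite : (Z : F₂^ r → Bool) →
  (∀ ys → All (λ y → Z y ≡ true) ys → odd (List.length ys) ≡ true → vsum ys ≢ 𝟎) →
  ∃ λ ψ → ∀ v → Z v ≡ true → ψ · v ≡ true
bipartite {r} Z noOddCircuit
  with separate (true ∷_) (List.filter Z? (allVecs r)) (All.all-filter Z? (allVecs r)) (true ∷ 𝟎)
  where
  Z? : ∀ v → Dec (Z v ≡ true)
  Z? v = Z v Data.Bool.≟ true
... | inj₁ (ys , Zys , sum) with trans (sym (vsum-true∷ ys)) sum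
...   | e = ⊥-elim (noOddCircuit ys Zys (cong Vec.head e) (cong Vec.tail e))
bipartite {r} Z noOddCircuit | inj₂ (false ∷ ψ , ψe , _) = ⊥-elim (true≢false (trans (sym ψe) (·-𝟎ʳ ψ)))
bipartite {r} Z noOddCircuit | inj₂ (true ∷ ψ , _ , ψZ) = ψ , λ v Zv →
  not-false (All.lookup ψZ (∈-filter⁺ (λ v → Z v Data.Bool.≟ true) (∈-allVecs v) Zv))

-- Excluding odd circuits.

odd⇒circuitLength : ∀ l → odd l ≡ true → (l ≡ 1 ⊎ l ≡ 3 ⊎ l ≡ 5) ⊎ (∃ λ j → l ≡ circuitLength j)
odd⇒circuitLength 1 _ = inj₁ (inj₁ refl)
odd⇒circuitLength (suc (suc l)) e with odd⇒circuitLength l (trans (sym (not-involutive _)) e)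
... | inj₁ (inj₁ refl)        = inj₁ (inj₂ (inj₁ refl))
... | inj₁ (inj₂ (inj₁ refl)) = inj₁ (inj₂ (inj₂ refl))
... | inj₁ (inj₂ (inj₂ refl)) = inj₂ (0 , refl)
... | inj₂ (j , eq)           = inj₂ (suc j , cong (2 ℕ.+_) eq)

circuitLength≡ : ∀ j → circuitLength j ≡ suc (2 ℕ.* (3 ℕ.+ j))
circuitLength≡ zero    = refl
circuitLength≡ (suc j) = trans (cong (2 ℕ.+_) (circuitLength≡ j))
  (cong suc (sym (ℕ.*-suc 2 (3 ℕ.+ j))))

4+j≤ : ∀ j → 4 ℕ.+ j ℕ.≤ 2 ℕ.^ (2 ℕ.+ j)
4+j≤ zero    = ℕ.≤-refl
4+j≤ (suc j) = ℕ.≤-trans (ℕ.+-mono-≤ (ℕ.m^n>0 2 (2 ℕ.+ j)) (4+j≤ j))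
  (ℕ.≤-reflexive (cong (2 ℕ.^ (2 ℕ.+ j) ℕ.+_) (sym (ℕ.+-identityʳ _))))

-- With K = 3 + k, the circuit bound reads 4 (K + 1) c ≤ K N and the packing bound gives 4 (K + 1) z
-- ≤ N because K + 1 ≤ p; they add up to 4 (c + z) ≤ N.
long-circuit-absurd : ∀ N c z k p → + 4 + k ≤ p → 0ℤ ≤ k → N < + 4 * (c + z) →
  + 8 * c ≤ (+ 2 * (+ 3 + k)) * (N - + 4 * c) → + 4 * p * z ≤ N → 0ℤ ≤ z → ⊥
long-circuit-absurd N c z k p k≤p 0≤k N<4cz bound pack 0≤z = negative-absurd
  (+-nonNeg (+-nonNeg (+-nonNeg (+-nonNeg (+-nonNeg (slack pack) (slack pack))
     (*-nonNeg (slack k≤p) (*-nonNeg {+ 8} (+≤+ z≤n) 0≤z)))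
     (*-nonNeg (+-nonNeg {+ 8} (+≤+ z≤n) (+-nonNeg 0≤k 0≤k)) (slack< N<4cz)))
     (slack bound)) (+-nonNeg (+-nonNeg 0≤k 0≤k) (+≤+ {0} {7} z≤n)))
  (arith N c z k p)
  where
  arith : ∀ N c z k p →
    ((((N - + 4 * p * z) + (N - + 4 * p * z)) + (p - (+ 4 + k)) * (+ 8 * z))
      + (+ 8 + (k + k)) * (+ 4 * (c + z) - N - 1ℤ)
      + ((+ 2 * (+ 3 + k)) * (N - + 4 * c) - + 8 * c)) + ((k + k) + + 7) ≡ - 1ℤ
  arith = solve-∀

short-circuit-absurd₁ : ∀ N c l → l ≤ + 4 → + 4 * c ≤ N → N < + 6 * c →
  + 8 * c ≤ l * (N - + 4 * c) → ⊥
short-circuit-absurd₁ N c l l≤4 4c≤N N<6c bound = negative-absurd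
  (+-nonNeg (+-nonNeg (+-nonNeg (slack bound) (*-nonNeg (slack l≤4) (slack 4c≤N)))
    (*-nonNeg {+ 4} (+≤+ z≤n) (slack< N<6c))) (+≤+ {0} {3} z≤n))
  (arith N c l)
  where
  arith : ∀ N c l → ((l * (N - + 4 * c) - + 8 * c) + (+ 4 - l) * (N - + 4 * c)) + + 4 * (+ 6 * c - N - 1ℤ) + + 3 ≡ - 1ℤ
  arith = solve-∀

short-circuit-absurd₂ : ∀ N c l → 0ℤ ≤ l → N ≤ + 4 * c → 0ℤ ≤ N → N < + 6 * c →
  + 8 * c ≤ l * (N - + 4 * c) → ⊥
short-circuit-absurd₂ N c l 0≤l N≤4c 0≤N N<6c bound = negative-absurd
  (+-nonNeg (+-nonNeg (+-nonNeg (*-nonNeg {+ 3} (+≤+ z≤n) (+-nonNeg (slack bound) (*-nonNeg 0≤l (slack N≤4c))))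
    (*-nonNeg {+ 4} (+≤+ z≤n) (slack< N<6c))) (*-nonNeg {+ 4} (+≤+ z≤n) 0≤N)) (+≤+ {0} {3} z≤n))
  (arith N c l)
  where
  arith : ∀ N c l → + 3 * ((l * (N - + 4 * c) - + 8 * c) + l * (+ 4 * c - N)) + + 4 * (+ 6 * c - N - 1ℤ) + + 4 * N + + 3 ≡ - 1ℤ
  arith = solve-∀

-- At l = 4 the bound is 6c ≤ N, so density 1/6 off the hyperplane is just what excludes circuits of
-- length up to 5. Replacing l by 4 requires 4c ≤ N, hence the case split.
short-circuit-absurd : ∀ N c l → 0ℤ ≤ l → l ≤ + 4 → 0ℤ ≤ N → N < + 6 * c →
  + 8 * c ≤ l * (N - + 4 * c) → ⊥
short-circuit-absurd N c l 0≤l l≤4 0≤N N<6c bound with ≤-total (+ 4 * c) N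
... | inj₁ 4c≤N = short-circuit-absurd₁ N c l l≤4 4c≤N N<6c bound
... | inj₂ N≤4c = short-circuit-absurd₂ N c l 0≤l N≤4c 0≤N N<6c bound

vec-of-length : (Z : F₂^ r → Bool) (ys : List (F₂^ r)) → All (λ y → Z y ≡ true) ys → ∀ {l} → List.length ys ≡ l →
  ∃ λ (xs : Vec (F₂^ r) l) → VecAll.All (λ x → Z x ≡ true) xs × vecSum xs ≡ vsum ys
vec-of-length Z []       []         refl = [] , [] , refl
vec-of-length Z (y ∷ ys) (Zy ∷ Zys) refl with vec-of-length Z ys Zys refl
... | xs , Zxs , sum = y ∷ xs , Zy ∷ Zxs , cong (y ⊕_) sum

module _ {r} (A : F₂^ r → Bool) (sf : SumFree A) (a : F₂^ r) where
  open SumFreeSplit A sf a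

  module _ (N<6c : N < + 6 * c) (N<4cz : N < + 4 * (c + z)) where

    private
      1≤c : 1ℤ ≤ c
      1≤c = ≮⇒≥ λ c<1 → negative-absurd
        (+-nonNeg (+-nonNeg (*-nonNeg {+ 6} (+≤+ z≤n) (slack< c<1)) (slack< N<6c)) (0≤card r)) (arith N c)
        where
        arith : ∀ N c → (+ 6 * (1ℤ - c - 1ℤ) + (+ 6 * c - N - 1ℤ)) + N ≡ - 1ℤ
        arith = solve-∀

      w : F₂^ r
      w = proj₁ (inhabited C 1≤c)

      aw : a · w ≡ true
      aw = C⇒· (proj₂ (inhabited C 1≤c))

      NoCircuit : List (F₂^ r) → Set
      NoCircuit ys = All (λ y → Z y ≡ true) ys → odd (List.length ys) ≡ true → vsum ys ≢ 𝟎

      ·-vsum : ∀ ys → All (λ y → Z y ≡ true) ys → a · vsum ys ≡ false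
      ·-vsum []       []         = ·-𝟎ʳ a
      ·-vsum (y ∷ ys) (Zy ∷ Zys) = trans (·-⊕ʳ a y (vsum ys)) (cong₂ _xor_ (Z⇒· Zy) (·-vsum ys Zys))

      -- A code combination equal to `u ⊕ v` with `u` and `v` in `Z` would give an odd circuit of
      -- length at most 2 + `coBound j`, two less than the shortest. The vector `w` off the
      -- hyperplane serves as one more generator, as sums of two members of `Z` stay on the
      -- hyperplane.
      shortest-circuit-packing : ∀ j ys → List.length ys ≡ circuitLength j → All (λ y → Z y ≡ true) ys → vsum ys ≡ 𝟎 →
        (∀ zs → List.length zs ℕ.< List.length ys → NoCircuit zs) → card (4 ℕ.+ j) * z ≤ N
      shortest-circuit-packing j ys len Zys sum shortest with vec-of-length Z ys Zys len
      ... | xs , Zxs , sum′ with code Z j xs Zxs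
      ...   | gs , spec = packing Z (w ∷ gs) λ where
              (false ∷ b) b≢0 u v Zu Zv e → old b (λ { refl → b≢0 refl }) u v Zu Zv e
              (true ∷ b) _ u v Zu Zv e → true≢false (trans (sym (on-hyperplane b (search (_· b))))
                (trans (cong (a ·_) e) (trans (·-⊕ʳ a u v) (cong₂ _xor_ (Z⇒· Zu) (Z⇒· Zv)))))
        where
        co : ∀ b zs → apply gs b ⊕ vsum zs ≡ vecSum xs → apply gs b ≡ vsum zs
        co b zs e = ⊕≡𝟎⇒≡ (apply gs b) (vsum zs) (trans e (trans sum′ sum))
        old : ∀ b → b ≢ 𝟎 → ∀ u v → Z u ≡ true → Z v ≡ true → apply gs b ≢ u ⊕ v
        old b b≢0 u v Zu Zv e with spec b b≢0
        ... | zs , Zzs , oddzs , short , sumzs = shortest (u ∷ v ∷ zs)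
                (subst (suc (suc (suc (List.length zs))) ℕ.≤_) (sym (trans len (circuitLength≡4+coBound j)))
                  (s≤s (s≤s (s≤s (ℕ.m≤n⇒m≤1+n short)))))
                (Zu ∷ Zv ∷ Zzs) (trans (not-involutive _) oddzs)
                (trans (sym (⊕-assoc u v (vsum zs)))
                  (trans (cong₂ _⊕_ (sym e) (sym (co b zs sumzs))) (⊕-self (apply gs b))))
        on-hyperplane : ∀ b → (∃ λ φ → φ · b ≡ true) ⊎ (∀ φ → φ · b ≡ false) → a · (w ⊕ apply gs b) ≡ true
        on-hyperplane b (inj₁ (φ , φb)) with spec b (separated⇒≢𝟎 {a = φ} φb)
        ... | zs , Zzs , _ , _ , sumzs = trans (·-⊕ʳ a w (apply gs b))
                (cong₂ _xor_ aw (trans (cong (a ·_) (co b zs sumzs)) (·-vsum zs Zzs)))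
        on-hyperplane b (inj₂ none) = trans (·-⊕ʳ a w (apply gs b))
                (cong₂ _xor_ aw (trans (cong (a ·_) (trans (cong (apply gs) (nondegenerate b none)) (apply-𝟎 gs))) (·-𝟎ʳ a)))

      short-circuit : (xs : List (F₂^ r)) → List.length xs ℕ.≤ 4 → + 8 * c ≤ lengthℤ xs * (N - + 4 * c) → ⊥
      short-circuit xs short bound = short-circuit-absurd N c (lengthℤ xs) (subst (0ℤ ≤_) (sym (lengthℤ≡ xs)) (+≤+ z≤n))
        (subst (_≤ + 4) (sym (lengthℤ≡ xs)) (+≤+ short)) (0≤card r) N<6c bound

      long-circuit : ∀ j u xs → List.length (u ∷ xs) ≡ circuitLength j → All (λ y → Z y ≡ true) (u ∷ xs) → vsum (u ∷ xs) ≡ 𝟎 →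
        (∀ zs → List.length zs ℕ.< List.length (u ∷ xs) → NoCircuit zs) →
        + 8 * c ≤ lengthℤ xs * (N - + 4 * c) → ⊥
      long-circuit j u xs len Zuxs sum shortest bound =
        long-circuit-absurd N c z (+ j) (card (2 ℕ.+ j)) (+≤+ (4+j≤ j)) (+≤+ z≤n) N<4cz
          (subst (λ l → + 8 * c ≤ l * (N - + 4 * c)) length≡ bound)
          (subst (λ p → p * z ≤ N) card≡ (shortest-circuit-packing j (u ∷ xs) len Zuxs sum shortest))
          (∣∣-≥0 Z)
        where
        length≡ : lengthℤ xs ≡ + 2 * (+ 3 + + j)
        length≡ = trans (lengthℤ≡ xs) (trans (cong +_ (ℕ.suc-injective (trans len (circuitLength≡ j)))) (pos-* 2 (3 ℕ.+ j)))
        card≡ : card (4 ℕ.+ j) ≡ + 4 * card (2 ℕ.+ j)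
        card≡ = trans (cong +_ (sym (ℕ.*-assoc 2 2 (2 ℕ.^ (2 ℕ.+ j))))) (pos-* 4 (2 ℕ.^ (2 ℕ.+ j)))

      -- Strong induction lets the circuit be assumed shortest. Lengths 1, 3 and 5 contradict the
      -- circuit bound alone; from 7 on the packing bound is needed too.
      no-odd-circuit : ∀ ys → Acc ℕ._<_ (List.length ys) → NoCircuit ys
      no-odd-circuit (u ∷ xs) (acc rec) (Zu ∷ Zxs) oddys sum = dispatch (odd⇒circuitLength (suc (List.length xs)) oddys) refl
        where
        bound : + 8 * c ≤ lengthℤ xs * (N - + 4 * c)
        bound = circuit-bound w aw Zu xs Zxs (trans (sym (not-involutive _)) (cong not oddys)) (sym (⊕≡𝟎⇒≡ u (vsum xs) sum))
        dispatch : ∀ {l} → (suc l ≡ 1 ⊎ suc l ≡ 3 ⊎ suc l ≡ 5) ⊎ (∃ λ j → suc l ≡ circuitLength j) → l ≡ List.length xs → ⊥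
        dispatch (inj₁ (inj₁ refl))        e = short-circuit xs (subst (ℕ._≤ 4) e z≤n) bound
        dispatch (inj₁ (inj₂ (inj₁ refl))) e = short-circuit xs (subst (ℕ._≤ 4) e (s≤s (s≤s z≤n))) bound
        dispatch (inj₁ (inj₂ (inj₂ refl))) e = short-circuit xs (subst (ℕ._≤ 4) e ℕ.≤-refl) bound
        dispatch (inj₂ (j , len))          e =
          long-circuit j u xs (trans (cong suc (sym e)) len) (Zu ∷ Zxs) sum (λ zs lt → no-odd-circuit zs (rec lt)) bound

    dense-part-bipartite : ∃ λ ψ → ∀ v → Z v ≡ true → ψ · v ≡ true
    dense-part-bipartite = bipartite Z λ ys → no-odd-circuit ys (ℕ.<-wellFounded _)

-- Dense sets without projective geometries

-- When `E` omits the origin this forces the columns of `M` to be independent, so they span a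
-- projective geometry.
PGIn : (F₂^ r → Bool) → Matrix r n → Set
PGIn E M = ∀ b → b ≢ 𝟎 → E (apply M b) ≡ true

-- The sumset of `B` and the span of `M`. For `B` the complement of `E`, a point lies outside
-- exactly when its whole coset lies in `E`.
hull : (F₂^ r → Bool) → Matrix r n → F₂^ r → Bool
hull B M v = any? (λ y → B (v ⊕ apply M y))

∣hull∣ : (B : F₂^ r → Bool) (M : Matrix r n) → ∣ hull B M ∣ ≤ card n * ∣ B ∣
∣hull∣ {n = n} B M = ≤-trans (∑-mono λ v → ind-any? (λ y → B (v ⊕ apply M y))) (≤-reflexive
  (trans (∑-swap (λ v y → ind (B (v ⊕ apply M y))))
    (trans (∑-cong (λ y → ∑-shift (ind ∘ B) (apply M y)))
      (trans (∑-const {n} ∣ B ∣) (*-comm ∣ B ∣ (card n))))))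

hull-intro : (B : F₂^ r → Bool) (M : Matrix r n) {v : F₂^ r} (y : F₂^ n) → B (v ⊕ apply M y) ≡ true → hull B M v ≡ true
hull-intro B M {v} y By with search (λ y → B (v ⊕ apply M y))
... | inj₁ _    = refl
... | inj₂ none = trans (sym (none y)) By

∉hull : (B : F₂^ r → Bool) (M : Matrix r n) {v : F₂^ r} → hull B M v ≡ false → ∀ y → B (v ⊕ apply M y) ≡ false
∉hull B M {v} = any?-none (λ y → B (v ⊕ apply M y))

bool-ext : ∀ {a b} → (a ≡ true → b ≡ true) → (b ≡ true → a ≡ true) → a ≡ b
bool-ext {true}  {b}     f g = sym (f refl)
bool-ext {false} {false} f g = refl
bool-ext {false} {true}  f g = g refl

hull-shift : (B : F₂^ r → Bool) (M : Matrix r n) (v : F₂^ r) (y : F₂^ n) →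
  hull B M v ≡ true → hull B M (v ⊕ apply M y) ≡ true
hull-shift B M v y v∈ with any?-witness (λ x → B (v ⊕ apply M x)) v∈
... | x , Bx = hull-intro B M (y ⊕ x) (trans (cong B
        (trans (cong ((v ⊕ apply M y) ⊕_) (apply-⊕ M y x))
          (xor-solve (v ∷ apply M y ∷ apply M x ∷ []) ((# 0 :⊕ # 1) :⊕ (# 1 :⊕ # 2)) (# 0 :⊕ # 2) refl))) Bx)

hull-invariant : (B : F₂^ r → Bool) (M : Matrix r n) (v : F₂^ r) (y : F₂^ n) →
  hull B M (v ⊕ apply M y) ≡ hull B M v
hull-invariant B M v y = bool-ext
  (λ p → subst (λ u → hull B M u ≡ true) (⊕-cancelʳ v (apply M y)) (hull-shift B M (v ⊕ apply M y) y p))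
  (hull-shift B M v y)

PGIn-∷ : (E : F₂^ r → Bool) (M : Matrix r n) → PGIn E M → ∀ {v} → hull (not ∘ E) M v ≡ false → PGIn E (v ∷ M)
PGIn-∷ E M pg v∉hull (false ∷ b) b≢0 = pg b λ { refl → b≢0 refl }
PGIn-∷ E M pg v∉hull (true ∷ b)  _   = not-false (∉hull (not ∘ E) M v∉hull b)

-- Translation by the span of `M` respects the two sides of the hyperplane, so the union bound holds
-- on each side separately.
∣hull∣₀ : (B : F₂^ r → Bool) (M : Matrix r n) (a : F₂^ r) → (∀ y → a · apply M y ≡ false) →
  ∣ hull B M ∣₀ a ∣ ≤ card n * ∣ B ∣₀ a ∣
∣hull∣₀ B M a a⊥M = ≤-trans (∑-mono λ v → ind-mono (inside v)) (∣hull∣ (B ∣₀ a) M)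
  where
  inside : ∀ v → (hull B M ∣₀ a) v ≡ true → hull (B ∣₀ a) M v ≡ true
  inside v p with ∧-true {hull B M v} p
  ... | Bv , av with any?-witness (λ y → B (v ⊕ apply M y)) Bv
  ...   | y , By = hull-intro (B ∣₀ a) M y
            (cong₂ _∧_ By (trans (cong not (trans (·-⊕ʳ a v (apply M y)) (trans (cong ((a · v) xor_) (a⊥M y)) (xor-identityʳ (a · v))))) av))

∣hull∣₁ : (B : F₂^ r → Bool) (M : Matrix r n) (a : F₂^ r) → (∀ y → a · apply M y ≡ false) →
  ∣ hull B M ∣₁ a ∣ ≤ card n * ∣ B ∣₁ a ∣
∣hull∣₁ B M a a⊥M = ≤-trans (∑-mono λ v → ind-mono (inside v)) (∣hull∣ (B ∣₁ a) M)
  where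
  inside : ∀ v → (hull B M ∣₁ a) v ≡ true → hull (B ∣₁ a) M v ≡ true
  inside v p with ∧-true {hull B M v} p
  ... | Bv , av with any?-witness (λ y → B (v ⊕ apply M y)) Bv
  ...   | y , By = hull-intro (B ∣₁ a) M y
            (cong₂ _∧_ By (trans (·-⊕ʳ a v (apply M y)) (trans (cong ((a · v) xor_) (a⊥M y)) (trans (xor-identityʳ (a · v)) av))))

card-*-mono : ∀ n {b} → 0ℤ ≤ b → card n * b ≤ card (suc n) * b
card-*-mono n {b} 0≤b = subst (λ k → card n * b ≤ k * b) (sym (card-suc n))
  (≤-by (*-nonNeg (0≤card n) 0≤b) (identity (card n) b))
  where
  identity : ∀ k b → k * b ≡ (k + k) * b - k * b
  identity = solve-∀

-- Greedy extension: as long as the hull of the complement does not cover the space, any point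
-- outside it can be added.
pg-exists : (E : F₂^ r → Bool) → E 𝟎 ≡ false → ∀ n → card n * ∣ not ∘ E ∣ < card r → ∃ λ (M : Matrix r n) → PGIn E M
pg-exists E E𝟎 zero _ = [] , λ { [] b≢0 → ⊥-elim (b≢0 refl) }
pg-exists {r} E E𝟎 (suc n) small
  with pg-exists E E𝟎 n (≤-<-trans (card-*-mono n (∣∣-≥0 (not ∘ E))) small)
... | M , pg with search (not ∘ hull (not ∘ E) M)
...   | inj₁ (v , v∉) = v ∷ M , PGIn-∷ E M pg (not-true v∉)
...   | inj₂ none     = ⊥-elim (<⇒≱ (≤-<-trans (≤-trans (∣hull∣ (not ∘ E) M) (card-*-mono n (∣∣-≥0 (not ∘ E)))) small)
                          (≤-reflexive (sym all)))
  where
  all : ∣ hull (not ∘ E) M ∣ ≡ card r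
  all = trans (∑-cong (λ v → cong ind (not-false (none v)))) (trans (∑-const {r} 1ℤ) (*-identityˡ (card r)))

-- The bias bounds c below by s N / (2 (N - s)), which increases with s and equals N/6 at s = N/4.
quarter⇒sixth : ∀ N s c → 1ℤ ≤ N → 0ℤ ≤ N - s → N < + 4 * s → s * N ≤ + 2 * c * (N - s) → N < + 6 * c
quarter⇒sixth N s c 1≤N 0≤N-s N<4s bias = ≰⇒> λ 6c≤N → negative-absurd
  (+-nonNeg (+-nonNeg (+-nonNeg (*-nonNeg (slack 6c≤N) 0≤N-s) (*-nonNeg {+ 3} (+≤+ z≤n) (slack bias)))
    (*-nonNeg (≤-trans 0≤1 1≤N) (slack< N<4s))) (slack 1≤N))
  (identity N s c)
  where
  identity : ∀ N s c → (((N - + 6 * c) * (N - s) + + 3 * (+ 2 * c * (N - s) - s * N)) + N * (+ 4 * s - N - 1ℤ)) + (N - 1ℤ) ≡ - 1ℤ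
  identity = solve-∀

-- The same lower bound equals N/4 at s = N/3.
third⇒quarter : ∀ N s c → 1ℤ ≤ N → 0ℤ ≤ N - s → N < + 3 * s → s * N ≤ + 2 * c * (N - s) → N < + 4 * c
third⇒quarter N s c 1≤N 0≤N-s N<3s bias = ≰⇒> λ 4c≤N → negative-absurd
  (+-nonNeg (+-nonNeg (+-nonNeg (*-nonNeg (slack 4c≤N) 0≤N-s) (*-nonNeg {+ 2} (+≤+ z≤n) (slack bias)))
    (*-nonNeg (≤-trans 0≤1 1≤N) (slack< N<3s))) (slack 1≤N))
  (identity N s c)
  where
  identity : ∀ N s c → (((N - + 4 * c) * (N - s) + + 2 * (+ 2 * c * (N - s) - s * N)) + N * (+ 3 * s - N - 1ℤ)) + (N - 1ℤ) ≡ - 1ℤ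
  identity = solve-∀

dense⇒nonempty : ∀ N s → 1ℤ ≤ N → N < + 4 * s → 1ℤ ≤ s
dense⇒nonempty N s 1≤N N<4s = ≮⇒≥ λ s<1 → negative-absurd
  (+-nonNeg (+-nonNeg (*-nonNeg {+ 4} (+≤+ z≤n) (slack< s<1)) (slack< N<4s)) (≤-trans 0≤1 1≤N))
  (identity N s)
  where
  identity : ∀ N s → (+ 4 * (1ℤ - s - 1ℤ) + (+ 4 * s - N - 1ℤ)) + N ≡ - 1ℤ
  identity = solve-∀

outside-nonNeg : (A : F₂^ r → Bool) → 0ℤ ≤ card r - ∣ A ∣
outside-nonNeg A = subst (0ℤ ≤_) (∣∣-not A) (∣∣-≥0 (not ∘ A))

-- The functional `a` comes from the bias, and `b` from the absence of odd circuits in the part of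
-- `A` on its hyperplane. This is the base case `t = 2`.
sumFree>¼ : (A : F₂^ r → Bool) → SumFree A → card r < + 4 * ∣ A ∣ →
  ∃ λ a → ∃ λ b → ∀ v → A v ≡ true → a · v ≡ false → b · v ≡ true
sumFree>¼ {r} A sf N<4s with sumFree⇒bias A sf (dense⇒nonempty (card r) ∣ A ∣ (1≤card r) N<4s)
... | a , bias with dense-part-bipartite A sf a
                      (quarter⇒sixth (card r) ∣ A ∣ ∣ A ∣₁ a ∣ (1≤card r) (outside-nonNeg A) N<4s bias)
                      (subst (λ s → card r < + 4 * s) (trans (∣∣-split A a) (+-comm ∣ A ∣₀ a ∣ ∣ A ∣₁ a ∣)) N<4s)
...   | b , bZ = a , b , λ v Av av → bZ v (cong₂ _∧_ Av (cong not av))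

sumFree>⅓ : (A : F₂^ r → Bool) → SumFree A → card r < + 3 * ∣ A ∣ →
  ∃ λ a → card r < + 4 * ∣ A ∣₁ a ∣ × (∀ v → A v ≡ true → a · v ≡ true)
sumFree>⅓ {r} A sf N<3s with sumFree⇒bias A sf (dense⇒nonempty (card r) ∣ A ∣ (1≤card r) N<4s)
  where
  N<4s : card r < + 4 * ∣ A ∣
  N<4s = <-≤-trans N<3s (≤-by (∣∣-≥0 A) (identity ∣ A ∣))
    where
    identity : ∀ s → s ≡ + 4 * s - + 3 * s
    identity = solve-∀
... | a , bias = a , N<4c , SumFreeSplit.majority A sf a N<4c
  where
  N<4c : card r < + 4 * ∣ A ∣₁ a ∣
  N<4c = third⇒quarter (card r) ∣ A ∣ ∣ A ∣₁ a ∣ (1≤card r) (outside-nonNeg A) N<3s bias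

-- Large Fourier coefficients of blocking sets

module _ {r} (B : F₂^ r → Bool) where

  private
    N b τ : ℤ
    N = card r
    b = ∣ B ∣
    f F conv² : F₂^ r → ℤ
    f = ind ∘ B
    F = fourier f
    conv² = conv f f
    τ = ∑ (λ x → f x * conv² x)

  ∑-conv : ∑ conv² ≡ b * b
  ∑-conv = trans (∑-swap (λ y x → f x * f (x ⊕ y)))
    (trans (∑-cong (λ x → trans (∑-*ˡ (f x) (λ y → f (x ⊕ y)))
                     (cong (f x *_) (trans (∑-cong (λ y → cong f (⊕-comm x y))) (∑-shift f x)))))
      (∑-*ʳ b f))

  -- The link of `x`: when `B` is the hull of the complement of `E`, these are the `v` for which the
  -- cosets of both `v` and `v ⊕ x` lie in `E`.
  coavoid : F₂^ r → F₂^ r → Bool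
  coavoid x v = not (B v) ∧ not (B (v ⊕ x))

  conv-coavoid : ∀ x → conv² x ≡ (b + b - N) + ∣ coavoid x ∣
  conv-coavoid x = trans (∑-cong pointwise)
    (trans (∑-+ (λ v → (f v + f (v ⊕ x)) - 1ℤ) (ind ∘ coavoid x))
      (cong (_+ ∣ coavoid x ∣) (trans (∑-- (λ v → f v + f (v ⊕ x)) (λ _ → 1ℤ))
        (cong₂ _-_ (trans (∑-+ f (λ v → f (v ⊕ x))) (cong (_+_ b) (∑-shift f x)))
                   (trans (∑-const {r} 1ℤ) (*-identityˡ N))))))
    where
    pointwise : ∀ v → f v * f (v ⊕ x) ≡ ((f v + f (v ⊕ x)) - 1ℤ) + ind (coavoid x v)
    pointwise v with B v | B (v ⊕ x)
    ... | false | false = refl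
    ... | false | true  = refl
    ... | true  | false = refl
    ... | true  | true  = refl

  -- Outside `B`, inclusion-exclusion and the sparse links keep 3 `conv²` at most 6b - 2N; as
  -- `conv²` has total b², the remainder must sit on `B`, which bounds `τ` from below.
  triples-bound : (∀ x → B x ≡ false → + 3 * ∣ coavoid x ∣ ≤ N) →
    + 3 * (b * b) ≤ + 3 * τ + (N - b) * (+ 6 * b - + 2 * N)
  triples-bound small = subst₂ _≤_ lhs rhs (∑-mono pointwise)
    where
    sparse : ∀ b N c → + 3 * c ≤ N → + 3 * ((b + b - N) + c) ≤ + 6 * b - + 2 * N
    sparse b N c p = ≤-by (slack p) (identity b N c)
      where
      identity : ∀ b N c → N - + 3 * c ≡ (+ 6 * b - + 2 * N) - + 3 * ((b + b - N) + c)
      identity = solve-∀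
    pointwise : ∀ x → + 3 * conv² x ≤ + 3 * (f x * conv² x) + (1ℤ - f x) * (+ 6 * b - + 2 * N)
    pointwise x = lemma (B x) refl
      where
      lemma : ∀ β → B x ≡ β → + 3 * conv² x ≤ + 3 * (ind β * conv² x) + (1ℤ - ind β) * (+ 6 * b - + 2 * N)
      lemma true  _ = ≤-reflexive (identity (conv² x) (+ 6 * b - + 2 * N))
        where
        identity : ∀ c d → + 3 * c ≡ + 3 * (1ℤ * c) + (1ℤ - 1ℤ) * d
        identity = solve-∀
      lemma false e = ≤-trans (subst (λ c → + 3 * c ≤ + 6 * b - + 2 * N) (sym (conv-coavoid x)) (sparse b N ∣ coavoid x ∣ (small x e)))
                              (≤-reflexive (identity (conv² x) (+ 6 * b - + 2 * N)))
        where
        identity : ∀ c d → d ≡ + 3 * (0ℤ * c) + (1ℤ - 0ℤ) * d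
        identity = solve-∀
    lhs : ∑ (λ x → + 3 * conv² x) ≡ + 3 * (b * b)
    lhs = trans (∑-*ˡ (+ 3) conv²) (cong (+ 3 *_) ∑-conv)
    rhs : ∑ (λ x → + 3 * (f x * conv² x) + (1ℤ - f x) * (+ 6 * b - + 2 * N)) ≡ + 3 * τ + (N - b) * (+ 6 * b - + 2 * N)
    rhs = trans (∑-+ (λ x → + 3 * (f x * conv² x)) (λ x → (1ℤ - f x) * (+ 6 * b - + 2 * N)))
      (cong₂ _+_ (∑-*ˡ (+ 3) (λ x → f x * conv² x))
        (trans (∑-*ʳ (+ 6 * b - + 2 * N) (λ x → 1ℤ - f x))
          (cong (_* (+ 6 * b - + 2 * N)) (trans (∑-- (λ _ → 1ℤ) f) (cong (_- b) (trans (∑-const {r} 1ℤ) (*-identityˡ N)))))))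

  -- With all nontrivial coefficients small, each nontrivial term of the weighted second moment is
  -- nonnegative, so its total is at least the trivial term; this bounds `τ` from above.
  fourier-bound : (∀ a → a ≢ 𝟎 → + 2 * F a + + 2 * b < N) →
    b * b * (N - + 4 * b) ≤ (N - + 2 * b) * (N * b) - + 2 * (N * τ)
  fourier-bound small = subst₂ _≤_ at-𝟎 total (∑-≥-𝟎 G nonNeg)
    where
    G : F₂^ r → ℤ
    G a = F a * F a * (N - + 2 * b - + 2 * F a)
    nonNeg : ∀ a → a ≢ 𝟎 → 0ℤ ≤ G a
    nonNeg a a≢0 = *-nonNeg (square-nonNeg (F a)) (≤-trans (slack (<⇒≤ (small a a≢0))) (≤-reflexive (identity N b (F a))))
      where
      identity : ∀ N b x → N - (+ 2 * x + + 2 * b) ≡ N - + 2 * b - + 2 * x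
      identity = solve-∀
    at-𝟎 : G 𝟎 ≡ b * b * (N - + 4 * b)
    at-𝟎 = trans (cong (λ x → x * x * (N - + 2 * b - + 2 * x)) (fourier-𝟎 f)) (identity b N)
      where
      identity : ∀ b N → b * b * (N - + 2 * b - + 2 * b) ≡ b * b * (N - + 4 * b)
      identity = solve-∀
    total : ∑ G ≡ (N - + 2 * b) * (N * b) - + 2 * (N * τ)
    total = trans (∑-cong (λ a → expand N b (F a)))
      (trans (∑-- (λ a → (N - + 2 * b) * (F a * F a)) (λ a → + 2 * (F a * (F a * F a))))
        (cong₂ _-_
          (trans (∑-*ˡ (N - + 2 * b) (λ a → F a * F a)) (cong ((N - + 2 * b) *_) (trans (∑-fourier² f) (cong (N *_) (conv-ind-𝟎 B)))))
          (trans (∑-*ˡ (+ 2) (λ a → F a * (F a * F a))) (cong (+ 2 *_) (∑-fourier³ f)))))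
      where
      expand : ∀ N b x → x * x * (N - + 2 * b - + 2 * x) ≡ (N - + 2 * b) * (x * x) - + 2 * (x * (x * x))
      expand = solve-∀

-- 16 (4N² - 15Nb + 12b²) = 3m² + 12Nm + N² for m = 3N - 8b, and the first two hypotheses say that
-- (N - b) (4N² - 15Nb + 12b²) ≤ 0.
density-absurd : ∀ N b T → 1ℤ ≤ N → + 8 * b < + 3 * N →
  + 3 * (b * b) ≤ + 3 * T + (N - b) * (+ 6 * b - + 2 * N) →
  b * b * (N - + 4 * b) ≤ (N - + 2 * b) * (N * b) - + 2 * (N * T) → ⊥
density-absurd N b T 1≤N 8b<3N p q = negative-absurd
  (+-nonNeg (+-nonNeg (*-nonNeg {+ 128} (+≤+ z≤n) (+-nonNeg (*-nonNeg {+ 3} (+≤+ z≤n) (slack q)) (*-nonNeg (*-nonNeg {+ 2} (+≤+ z≤n) 0≤N) (slack p))))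
     (+-nonNeg (*-nonNeg (+-nonNeg 0≤m (*-nonNeg {+ 5} (+≤+ z≤n) 0≤N)) (*-nonNeg {+ 3} (+≤+ z≤n) (+-nonNeg (square-nonNeg (+ 3 * N - + 8 * b)) (*-nonNeg (*-nonNeg {+ 4} (+≤+ z≤n) 0≤N) 0≤m))))
       (+-nonNeg (*-nonNeg 0≤m (square-nonNeg N)) (*-nonNeg {+ 4} (+≤+ z≤n) (*-nonNeg 0≤N (square-nonNeg N))))))
     (*-nonNeg (slack 1≤N) (+-nonNeg (+-nonNeg (square-nonNeg N) 0≤N) 0≤1)))
  (identity N b T)
  where
  0≤N : 0ℤ ≤ N
  0≤N = ≤-trans 0≤1 1≤N
  0≤m : 0ℤ ≤ + 3 * N - + 8 * b
  0≤m = slack (<⇒≤ 8b<3N)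
  identity : ∀ N b T →
    + 128 * (+ 3 * ((N - + 2 * b) * (N * b) - + 2 * (N * T) - b * b * (N - + 4 * b))
             + + 2 * N * (+ 3 * T + (N - b) * (+ 6 * b - + 2 * N) - + 3 * (b * b)))
    + ((+ 3 * N - + 8 * b + + 5 * N) * (+ 3 * ((+ 3 * N - + 8 * b) * (+ 3 * N - + 8 * b) + + 4 * N * (+ 3 * N - + 8 * b)))
       + ((+ 3 * N - + 8 * b) * (N * N) + + 4 * (N * (N * N))))
    + (N - 1ℤ) * (N * N + N + 1ℤ) ≡ - 1ℤ
  identity = solve-∀

≢𝟎⇒nonzero : (a : F₂^ r) → a ≢ 𝟎 → ∃ λ w → a · w ≡ true
≢𝟎⇒nonzero []          a≢0 = ⊥-elim (a≢0 refl)
≢𝟎⇒nonzero (true ∷ a)  _   = true ∷ 𝟎 , cong not (·-𝟎ʳ a)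
≢𝟎⇒nonzero (false ∷ a) a≢0 with ≢𝟎⇒nonzero a (λ { refl → a≢0 refl })
... | w , aw = false ∷ w , aw

-- The conclusion amounts to N ≤ 4 |B ∩ H| for the hyperplane H of `a`. If it failed for every
-- nonzero `a`, the lower and upper bounds on the number of additive triples would clash by
-- `density-absurd`.
heavy-character : (B : F₂^ r → Bool) → + 8 * ∣ B ∣ < + 3 * card r →
  (∀ x → B x ≡ false → + 3 * ∣ coavoid B x ∣ ≤ card r) →
  ∃ λ a → ∃ λ w → a · w ≡ true × card r ≤ + 2 * fourier (ind ∘ B) a + + 2 * ∣ B ∣
heavy-character {r} B 8b<3N small
  with search (λ a → any? (a ·_) ∧ does (card r ≤? + 2 * fourier (ind ∘ B) a + + 2 * ∣ B ∣))
... | inj₁ (a , e) = a , proj₁ aw , proj₂ aw , decided (proj₂ (∧-true {any? (a ·_)} e))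
  where
  aw = any?-witness (a ·_) (proj₁ (∧-true {any? (a ·_)} e))
  decided : does (card r ≤? + 2 * fourier (ind ∘ B) a + + 2 * ∣ B ∣) ≡ true → card r ≤ + 2 * fourier (ind ∘ B) a + + 2 * ∣ B ∣
  decided e with card r ≤? + 2 * fourier (ind ∘ B) a + + 2 * ∣ B ∣
  ... | yes p = p
... | inj₂ none = ⊥-elim (density-absurd (card r) ∣ B ∣ (∑ (λ x → ind (B x) * conv (ind ∘ B) (ind ∘ B) x)) (1≤card r) 8b<3N
                    (triples-bound B small) (fourier-bound B light))
  where
  light : ∀ a → a ≢ 𝟎 → + 2 * fourier (ind ∘ B) a + + 2 * ∣ B ∣ < card r
  light a a≢0 = ≰⇒> λ heavy → refute heavy (none a)
    where
    a-nonzero : any? (a ·_) ≡ true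
    a-nonzero with search (a ·_)
    ... | inj₁ _ = refl
    ... | inj₂ zeros with ≢𝟎⇒nonzero a a≢0
    ...   | w , aw = trans (sym (zeros w)) aw
    refute : card r ≤ + 2 * fourier (ind ∘ B) a + + 2 * ∣ B ∣ →
      any? (a ·_) ∧ does (card r ≤? + 2 * fourier (ind ∘ B) a + + 2 * ∣ B ∣) ≡ false → ⊥
    refute heavy e with card r ≤? + 2 * fourier (ind ∘ B) a + + 2 * ∣ B ∣
    ... | no ¬heavy = ¬heavy heavy
    ... | yes _ = true≢false (trans (sym (cong (_∧ true) a-nonzero)) e)

∉hull-∷ : (B : F₂^ r → Bool) (M : Matrix r n) {v x : F₂^ r} →
  hull B M v ≡ false → hull B M (v ⊕ x) ≡ false → hull B (x ∷ M) v ≡ false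
∉hull-∷ B M {v} {x} v∉ vx∉ with hull B (x ∷ M) v in e
... | false = refl
... | true with any?-witness (λ y → B (v ⊕ apply (x ∷ M) y)) e
...   | false ∷ y , By = trans (sym By) (∉hull B M v∉ y)
...   | true ∷ y  , By = trans (sym By) (trans (cong B (sym (⊕-assoc v x (apply M y)))) (∉hull B M vx∉ y))

hull-∷ˡ : (B : F₂^ r → Bool) (M : Matrix r n) {v x : F₂^ r} →
  hull B M v ≡ true → hull B (x ∷ M) v ≡ true
hull-∷ˡ B M {v} {x} v∈ with any?-witness (λ y → B (v ⊕ apply M y)) v∈
... | y , By = hull-intro B (x ∷ M) (false ∷ y) By

hull-∷ʳ : (B : F₂^ r → Bool) (M : Matrix r n) {v x : F₂^ r} →
  hull B M (v ⊕ x) ≡ true → hull B (x ∷ M) v ≡ true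
hull-∷ʳ B M {v} {x} vx∈ with any?-witness (λ y → B ((v ⊕ x) ⊕ apply M y)) vx∈
... | y , By = hull-intro B (x ∷ M) (true ∷ y) (trans (cong B (sym (⊕-assoc v x (apply M y)))) By)

2∣halfspace∣ : (a w : F₂^ r) → a · w ≡ true → + 2 * ∣ not ∘ (a ·_) ∣ ≡ card r
2∣halfspace∣ {r} a w aw = trans (cong (+ 2 *_) (∣∣-not (a ·_)))
  (trans (cong (λ n → + 2 * (n - ∣ (a ·_) ∣)) (sym (∣hyperplane∣ a w aw)))
    (trans (identity ∣ (a ·_) ∣) (∣hyperplane∣ a w aw)))
  where
  identity : ∀ h → + 2 * (h + h - h) ≡ h + h
  identity = solve-∀

card-double : ∀ n → card (suc n) ≡ + 2 * card n
card-double n = pos-* 2 (2 ℕ.^ n)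

card-quadruple : ∀ n → card (2 ℕ.+ n) ≡ + 4 * card n
card-quadruple n = trans (cong +_ (sym (ℕ.*-assoc 2 2 (2 ℕ.^ n)))) (pos-* 4 (2 ℕ.^ n))

card-octuple : ∀ n → card (3 ℕ.+ n) ≡ + 8 * card n
card-octuple n = trans (cong +_ (trans (cong (2 ℕ.*_) (sym (ℕ.*-assoc 2 2 (2 ℕ.^ n)))) (sym (ℕ.*-assoc 2 4 (2 ℕ.^ n))))) (pos-* 8 (2 ℕ.^ n))

-- The span of `M` preserves the hull, and translation by `x` swaps the two conditions.
coavoid-shift : (B : F₂^ r → Bool) (M : Matrix r n) (x v : F₂^ r) (y : F₂^ (suc n)) →
  coavoid (hull B M) x v ≡ true → coavoid (hull B M) x (v ⊕ apply (x ∷ M) y) ≡ true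
coavoid-shift B M x v (false ∷ y) p with ∧-true {not (hull B M v)} p
... | q , q′ = cong₂ (λ s t → not s ∧ not t)
  (trans (hull-invariant B M v y) (not-true q))
  (trans (cong (hull B M) (xor-solve (v ∷ apply M y ∷ x ∷ []) ((# 0 :⊕ # 1) :⊕ # 2) ((# 0 :⊕ # 2) :⊕ # 1) refl))
    (trans (hull-invariant B M (v ⊕ x) y) (not-true q′)))
coavoid-shift B M x v (true ∷ y) p with ∧-true {not (hull B M v)} p
... | q , q′ = cong₂ (λ s t → not s ∧ not t)
  (trans (cong (hull B M) (sym (⊕-assoc v x (apply M y)))) (trans (hull-invariant B M (v ⊕ x) y) (not-true q′)))
  (trans (cong (hull B M) (xor-solve (v ∷ apply M y ∷ x ∷ []) ((# 0 :⊕ (# 2 :⊕ # 1)) :⊕ # 2) (# 0 :⊕ # 1) refl))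
    (trans (hull-invariant B M v y) (not-true q)))

-- Here `w` certifies that `a` is nonzero. With t = 3 + k and 2^t |B| < 3N, such a hyperplane holds
-- more than two thirds of `B`.
HeavyHyperplane : (F₂^ r → Bool) → ℕ → Set
HeavyHyperplane {r} B k = ∃ λ a → ∃ λ w → a · w ≡ true × card r ≤ card (2 ℕ.+ k) * ∣ B ∣₀ a ∣

module _ {r k} (E : F₂^ r → Bool) (M : Matrix r k) (pg : PGIn E M) where

  private
    B B̂ : F₂^ r → Bool
    B = not ∘ E
    B̂ = hull B M

  -- If `u`, `v` and `u ⊕ v` were all in the link, then `u`, `v`, `x` and `M` would span a forbidden
  -- geometry.
  coavoid-sumFree : (∀ (M′ : Matrix r (3 ℕ.+ k)) → ¬ PGIn E M′) → ∀ x → B̂ x ≡ false → SumFree (coavoid B̂ x)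
  coavoid-sumFree free x x∉ u v pu pv puv = free (u ∷ v ∷ x ∷ M)
    (PGIn-∷ E (v ∷ x ∷ M) (PGIn-∷ E (x ∷ M) (PGIn-∷ E M pg x∉) (outside v pv))
      (∉hull-∷ B (x ∷ M) (outside u pu) (outside (u ⊕ v) puv)))
    where
    outside : ∀ v → coavoid B̂ x v ≡ true → hull B (x ∷ M) v ≡ false
    outside v p with ∧-true {not (B̂ v)} p
    ... | q , q′ = ∉hull-∷ B M (not-true q) (not-true q′)

  -- The link is invariant under the span of `x ∷ M`, so `a` vanishes on that span. Every coset of
  -- it inside the hyperplane avoids the link and hence meets `B`, so 2^(k+1) translates of the part
  -- of `B` on the hyperplane cover its N/2 points.
  heavy-from-link-bias : ∀ x a → card r < + 4 * ∣ coavoid B̂ x ∣₁ a ∣ →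
    (∀ v → coavoid B̂ x v ≡ true → a · v ≡ true) → HeavyHyperplane B k
  heavy-from-link-bias x a N<4c A⊂ = a , w , aw , combine (2∣halfspace∣ a w aw) covered
    where
    A = coavoid B̂ x
    1≤c : 1ℤ ≤ ∣ A ∣₁ a ∣
    1≤c = dense⇒nonempty (card r) ∣ A ∣₁ a ∣ (1≤card r) N<4c
    w : F₂^ r
    w = proj₁ (inhabited (A ∣₁ a) 1≤c)
    Aw : A w ≡ true
    Aw = proj₁ (∧-true {A w} (proj₂ (inhabited (A ∣₁ a) 1≤c)))
    aw : a · w ≡ true
    aw = A⊂ w Aw
    a⊥ : ∀ y → a · apply (x ∷ M) y ≡ false
    a⊥ y with a · apply (x ∷ M) y in ay
    ... | false = refl
    ... | true  = trans (sym (A⊂ (w ⊕ apply (x ∷ M) y) (coavoid-shift B M x w y Aw))) (trans (·-⊕ʳ a w (apply (x ∷ M) y)) (cong₂ _xor_ aw ay))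
    in-hull : ∀ v → not (a · v) ≡ true → (hull B (x ∷ M) ∣₀ a) v ≡ true
    in-hull v av with B̂ v in Bv | B̂ (v ⊕ x) in Bvx
    ... | true  | _     = cong₂ _∧_ (hull-∷ˡ B M Bv) av
    ... | false | true  = cong₂ _∧_ (hull-∷ʳ B M Bvx) av
    ... | false | false = ⊥-elim (true≢false (trans (sym (A⊂ v (cong₂ (λ s t → not s ∧ not t) Bv Bvx))) (not-true av)))
    covered : ∣ not ∘ (a ·_) ∣ ≤ card (suc k) * ∣ B ∣₀ a ∣
    covered = ≤-trans (∑-mono (λ v → ind-mono (in-hull v))) (∣hull∣₀ B (x ∷ M) a a⊥)
    combine : + 2 * ∣ not ∘ (a ·_) ∣ ≡ card r → ∣ not ∘ (a ·_) ∣ ≤ card (suc k) * ∣ B ∣₀ a ∣ →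
      card r ≤ card (2 ℕ.+ k) * ∣ B ∣₀ a ∣
    combine e p = subst₂ _≤_ e
      (trans (sym (*-assoc (+ 2) (card (suc k)) ∣ B ∣₀ a ∣)) (cong (_* ∣ B ∣₀ a ∣) (sym (card-double (suc k)))))
      (*-monoˡ-≤-nonNeg (+ 2) p)

  heavy-from-link : (∀ (M′ : Matrix r (3 ℕ.+ k)) → ¬ PGIn E M′) → ∀ x → B̂ x ≡ false →
    card r < + 3 * ∣ coavoid B̂ x ∣ → HeavyHyperplane B k
  heavy-from-link free x x∉ dense = from (sumFree>⅓ (coavoid B̂ x) (coavoid-sumFree free x x∉) dense)
    where
    from : (∃ λ a → card r < + 4 * ∣ coavoid B̂ x ∣₁ a ∣ × (∀ v → coavoid B̂ x v ≡ true → a · v ≡ true)) → HeavyHyperplane B k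
    from (a , N<4c , A⊂) = heavy-from-link-bias x a N<4c A⊂

  -- If `a` were 1 somewhere on the span of `M`, that translation would swap the two halves of the
  -- hull, making it at least N/2 and not below 3N/8. So `a` vanishes on the span and the count
  -- passes from the hull to `B`.
  heavy-from-biased-character : + 8 * ∣ B̂ ∣ < + 3 * card r → ∀ a w → a · w ≡ true →
    card r ≤ + 2 * fourier (ind ∘ B̂) a + + 2 * ∣ B̂ ∣ → HeavyHyperplane B k
  heavy-from-biased-character small a w aw heavy = a , w , aw ,
      subst (card r ≤_) (trans (sym (*-assoc (+ 4) (card k) ∣ B ∣₀ a ∣)) (cong (_* ∣ B ∣₀ a ∣) (sym (card-quadruple k))))
        (≤-trans 4B̂₀ (*-monoˡ-≤-nonNeg (+ 4) (∣hull∣₀ B M a a⊥)))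
    where
    b₀ = ∣ B̂ ∣₀ a ∣
    b₁ = ∣ B̂ ∣₁ a ∣
    heavy′ : card r ≤ + 2 * (b₀ - b₁) + + 2 * (b₀ + b₁)
    heavy′ = subst₂ (λ F b → card r ≤ + 2 * F + + 2 * b) (fourier-ind B̂ a) (∣∣-split B̂ a) heavy
    4B̂₀ : card r ≤ + 4 * b₀
    4B̂₀ = subst (card r ≤_) (identity b₀ b₁) heavy′
      where
      identity : ∀ p q → + 2 * (p - q) + + 2 * (p + q) ≡ + 4 * p
      identity = solve-∀
    unbiased : ∀ N p q → p ≡ q → 1ℤ ≤ N → + 8 * (p + q) < + 3 * N → N ≤ + 4 * p → ⊥
    unbiased N p .p refl 1≤N lt ge = negative-absurd
      (+-nonNeg (+-nonNeg (+-nonNeg (slack< lt) (*-nonNeg {+ 4} (+≤+ z≤n) (slack ge))) (slack 1≤N)) 0≤1)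
      (identity N p)
      where
      identity : ∀ N p → (+ 3 * N - + 8 * (p + p) - 1ℤ) + + 4 * (+ 4 * p - N) + (N - 1ℤ) + 1ℤ ≡ - 1ℤ
      identity = solve-∀
    a⊥ : ∀ y → a · apply M y ≡ false
    a⊥ y with a · apply M y in ay
    ... | false = refl
    ... | true  = ⊥-elim (unbiased (card r) b₀ b₁ balanced (1≤card r) (subst (λ b → + 8 * b < + 3 * card r) (∣∣-split B̂ a) small) 4B̂₀)
      where
      complement : ∀ b → not (b xor true) ≡ b
      complement false = refl
      complement true  = refl
      balanced : b₀ ≡ b₁
      balanced = trans (sym (∑-shift (ind ∘ B̂ ∣₀ a) (apply M y)))
        (∑-cong λ v → cong ind (cong₂ _∧_ (hull-invariant B M v y)
          (trans (cong not (trans (·-⊕ʳ a v (apply M y)) (cong ((a · v) xor_) ay))) (complement (a · v)))))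

  heavy-from-character : + 8 * ∣ B̂ ∣ < + 3 * card r →
    (∀ x → B̂ x ≡ false → + 3 * ∣ coavoid B̂ x ∣ ≤ card r) → HeavyHyperplane B k
  heavy-from-character small sparse = from (heavy-character B̂ small sparse)
    where
    from : (∃ λ a → ∃ λ w → a · w ≡ true × card r ≤ + 2 * fourier (ind ∘ B̂) a + + 2 * ∣ B̂ ∣) → HeavyHyperplane B k
    from (a , w , aw , heavy) = heavy-from-biased-character small a w aw heavy

-- The density gives a geometry of dimension k whose hull has fewer than 3N/8 points. A link of
-- density above 1/3 yields the hyperplane by bias, and if there is none the character argument
-- applies.
heavy-hyperplane : ∀ k (E : F₂^ r → Bool) → E 𝟎 ≡ false → (∀ (M : Matrix r (3 ℕ.+ k)) → ¬ PGIn E M) →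
  card (3 ℕ.+ k) * ∣ not ∘ E ∣ < + 3 * card r → HeavyHyperplane (not ∘ E) k
heavy-hyperplane {r} k E E𝟎 free dense = from-geometry (pg-exists E E𝟎 k k-small)
  where
  B = not ∘ E
  8kB<3N : + 8 * (card k * ∣ B ∣) < + 3 * card r
  8kB<3N = subst (_< + 3 * card r) (trans (cong (_* ∣ B ∣) (card-octuple k)) (*-assoc (+ 8) (card k) ∣ B ∣)) dense
  k-small : card k * ∣ B ∣ < card r
  k-small = arith (card k * ∣ B ∣) (card r) (*-nonNeg (0≤card k) (∣∣-≥0 B)) 8kB<3N
    where
    arith : ∀ b N → 0ℤ ≤ b → + 8 * b < + 3 * N → b < N
    arith b N 0≤b lt = ≰⇒> λ N≤b → negative-absurd
      (+-nonNeg (+-nonNeg (slack< lt) (*-nonNeg {+ 3} (+≤+ z≤n) (slack N≤b))) (*-nonNeg {+ 5} (+≤+ z≤n) 0≤b)) (identity b N)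
      where
      identity : ∀ b N → (+ 3 * N - + 8 * b - 1ℤ) + + 3 * (b - N) + + 5 * b ≡ - 1ℤ
      identity = solve-∀
  from-geometry : (∃ λ (M : Matrix r k) → PGIn E M) → HeavyHyperplane B k
  from-geometry (M , pg) with search (λ x → not (hull B M x) ∧ does (card r <? + 3 * ∣ coavoid (hull B M) x ∣))
  ... | inj₁ (x , e) = heavy-from-link E M pg free x (not-true (proj₁ (∧-true {not (hull B M x)} e)))
                         (decided (proj₂ (∧-true {not (hull B M x)} e)))
    where
    decided : does (card r <? + 3 * ∣ coavoid (hull B M) x ∣) ≡ true → card r < + 3 * ∣ coavoid (hull B M) x ∣
    decided e with card r <? + 3 * ∣ coavoid (hull B M) x ∣
    ... | yes p = p
  ... | inj₂ none = heavy-from-character E M pg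
      (≤-<-trans (*-monoˡ-≤-nonNeg (+ 8) (∣hull∣ B M)) 8kB<3N)
      λ x x∉ → ≮⇒≥ λ lt → refute x x∉ lt (none x)
    where
    refute : ∀ x → hull B M x ≡ false → card r < + 3 * ∣ coavoid (hull B M) x ∣ →
      not (hull B M x) ∧ does (card r <? + 3 * ∣ coavoid (hull B M) x ∣) ≡ false → ⊥
    refute x x∉ lt e with card r <? + 3 * ∣ coavoid (hull B M) x ∣
    ... | no ¬lt = ¬lt lt
    ... | yes _  = true≢false (trans (sym (cong (λ b → not b ∧ true) x∉)) e)

-- Induction along heavy hyperplanes.

values : Vec (F₂^ r) n → F₂^ r → F₂^ n
values Φ v = Vec.map (_· v) Φ

Separates : Vec (F₂^ r) n → (F₂^ r → Bool) → Set
Separates Φ E = ∀ v → E v ≡ true → values Φ v ≢ 𝟎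

dense-complement : ∀ N e p → p * (N - e) < + 3 * N → (p - + 3) * N < p * e
dense-complement N e p lt = ≰⇒> λ le → negative-absurd (+-nonNeg (slack< lt) (slack le)) (identity N e p)
  where
  identity : ∀ N e p → (+ 3 * N - p * (N - e) - 1ℤ) + ((p - + 3) * N - p * e) ≡ - 1ℤ
  identity = solve-∀

triangle-free : (E : F₂^ r → Bool) → (∀ (M : Matrix r 2) → ¬ PGIn E M) → SumFree E
triangle-free E free u v Eu Ev Euv = free (u ∷ v ∷ []) λ where
  (false ∷ false ∷ []) b≢0 → ⊥-elim (b≢0 refl)
  (true ∷ false ∷ [])  _   → trans (cong E (⊕-identityʳ u)) Eu
  (false ∷ true ∷ [])  _   → trans (cong E (⊕-identityʳ v)) Ev
  (true ∷ true ∷ [])   _   → trans (cong (λ x → E (u ⊕ x)) (⊕-identityʳ v)) Euv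

module Projection {r} (a w : F₂^ r) (aw : a · w ≡ true) where

  shiftBy : Bool → F₂^ r → F₂^ r
  shiftBy false v = v
  shiftBy true  v = v ⊕ w

  -- The projection along `w` onto the hyperplane of `a`.
  π : F₂^ r → F₂^ r
  π v = shiftBy (a · v) v

  π-fix : ∀ v → a · v ≡ false → π v ≡ v
  π-fix v av = cong (λ b → shiftBy b v) av

  π-⊥ : ∀ v → a · π v ≡ false
  π-⊥ v with a · v in av
  ... | false = av
  ... | true  = trans (·-⊕ʳ a v w) (cong₂ _xor_ av aw)

  π-𝟎 : π 𝟎 ≡ 𝟎
  π-𝟎 = π-fix 𝟎 (·-𝟎ʳ a)

  shiftBy-⊕ : ∀ b c u v → shiftBy (b xor c) (u ⊕ v) ≡ shiftBy b u ⊕ shiftBy c v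
  shiftBy-⊕ false false u v = refl
  shiftBy-⊕ false true  u v = ⊕-assoc u v w
  shiftBy-⊕ true  false u v = xor-solve (u ∷ v ∷ w ∷ []) ((# 0 :⊕ # 1) :⊕ # 2) ((# 0 :⊕ # 2) :⊕ # 1) refl
  shiftBy-⊕ true  true  u v = xor-solve (u ∷ v ∷ w ∷ []) (# 0 :⊕ # 1) ((# 0 :⊕ # 2) :⊕ (# 1 :⊕ # 2)) refl

  π-⊕ : ∀ u v → π (u ⊕ v) ≡ π u ⊕ π v
  π-⊕ u v = trans (cong (λ b → shiftBy b (u ⊕ v)) (·-⊕ʳ a u v)) (shiftBy-⊕ (a · u) (a · v) u v)

  π-apply : (M : Matrix r n) (b : F₂^ n) → apply (Vec.map π M) b ≡ π (apply M b)
  π-apply []      []          = sym π-𝟎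
  π-apply (c ∷ M) (false ∷ b) = π-apply M b
  π-apply (c ∷ M) (true ∷ b)  = trans (cong (π c ⊕_) (π-apply M b)) (sym (π-⊕ c (apply M b)))

  -- Each point of the hyperplane has two preimages, itself and its translate by `w`.
  ∣∘π∣ : (B : F₂^ r → Bool) → ∣ B ∘ π ∣ ≡ + 2 * ∣ B ∣₀ a ∣
  ∣∘π∣ B = trans (∑-cong pointwise)
    (trans (∑-+ (ind ∘ B ∣₀ a) (λ v → ind ((B ∣₀ a) (v ⊕ w))))
      (trans (cong (_+_ ∣ B ∣₀ a ∣) (∑-shift (ind ∘ B ∣₀ a) w)) (double ∣ B ∣₀ a ∣)))
    where
    double : ∀ x → x + x ≡ + 2 * x
    double = solve-∀
    lemma : ∀ v b → ind (B (shiftBy b v)) ≡ ind (B v ∧ not b) + ind (B (v ⊕ w) ∧ not (b xor true))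
    lemma v false with B v | B (v ⊕ w)
    ... | false | false = refl
    ... | false | true  = refl
    ... | true  | false = refl
    ... | true  | true  = refl
    lemma v true with B v | B (v ⊕ w)
    ... | false | false = refl
    ... | false | true  = refl
    ... | true  | false = refl
    ... | true  | true  = refl
    pointwise : ∀ v → ind (B (π v)) ≡ ind ((B ∣₀ a) v) + ind ((B ∣₀ a) (v ⊕ w))
    pointwise v = trans (lemma v (a · v))
      (cong (λ c → ind ((B ∣₀ a) v) + ind (B (v ⊕ w) ∧ not c)) (sym (trans (·-⊕ʳ a v w) (cong ((a · v) xor_) aw))))

heavy-arith : ∀ N b b₀ b₁ q → b ≡ b₀ + b₁ → (+ 2 * q) * b < + 3 * N → N ≤ q * b₀ → + 2 * (q * b₁) < N
heavy-arith N .(b₀ + b₁) b₀ b₁ q refl lt heavy = ≰⇒> λ ge → negative-absurd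
  (+-nonNeg (+-nonNeg (slack< lt) (*-nonNeg {+ 2} (+≤+ z≤n) (slack heavy))) (slack ge)) (identity N b₀ b₁ q)
  where
  identity : ∀ N b₀ b₁ q → (+ 3 * N - (+ 2 * q) * (b₀ + b₁) - 1ℤ) + + 2 * (q * b₀ - N) + (+ 2 * (q * b₁) - N) ≡ - 1ℤ
  identity = solve-∀

-- Pulling back doubles `b₀` while the power of two in front is halved, so the threshold 3N is
-- inherited.
restriction-arith : ∀ N b b₀ b₁ q → 0ℤ ≤ q → 0ℤ ≤ b₁ → b ≡ b₀ + b₁ → (+ 2 * q) * b < + 3 * N → q * (+ 2 * b₀) < + 3 * N
restriction-arith N .(b₀ + b₁) b₀ b₁ q 0≤q 0≤b₁ refl lt = ≤-<-trans
  (≤-by (*-nonNeg (*-nonNeg {+ 2} (+≤+ z≤n) 0≤q) 0≤b₁) (identity b₀ b₁ q)) lt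
  where
  identity : ∀ b₀ b₁ q → + 2 * q * b₁ ≡ (+ 2 * q) * (b₀ + b₁) - q * (+ 2 * b₀)
  identity = solve-∀

dense⇒separated : ∀ k (E : F₂^ r → Bool) → E 𝟎 ≡ false → (∀ (M : Matrix r (2 ℕ.+ k)) → ¬ PGIn E M) →
  card (2 ℕ.+ k) * ∣ not ∘ E ∣ < + 3 * card r → ∃ λ (Φ : Vec (F₂^ r) (2 ℕ.+ k)) → Separates Φ E
dense⇒separated {r} zero E E𝟎 free dense = from (sumFree>¼ E (triangle-free E free) N<4e)
  where
  N<4e : card r < + 4 * ∣ E ∣
  N<4e = subst (_< + 4 * ∣ E ∣) (identity (card r))
    (dense-complement (card r) ∣ E ∣ (+ 4) (subst (λ b → + 4 * b < + 3 * card r) (∣∣-not E) dense))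
    where
    identity : ∀ N → (+ 4 - + 3) * N ≡ N
    identity N = *-identityˡ N
  from : (∃ λ a → ∃ λ b → ∀ v → E v ≡ true → a · v ≡ false → b · v ≡ true) → ∃ λ Φ → Separates Φ E
  from (a , b , ab) = a ∷ b ∷ [] , λ v Ev e →
    true≢false (trans (sym (ab v Ev (cong Vec.head e))) (cong (Vec.head ∘ Vec.tail) e))
dense⇒separated {r} (suc k) E E𝟎 free dense = from (heavy-hyperplane k E E𝟎 free dense)
  where
  B = not ∘ E
  q = card (2 ℕ.+ k)
  dense′ : (+ 2 * q) * ∣ B ∣ < + 3 * card r
  dense′ = subst (λ p → p * ∣ B ∣ < + 3 * card r) (card-double (2 ℕ.+ k)) dense
  module _ (a w : F₂^ r) (aw : a · w ≡ true) (heavy : card r ≤ q * ∣ B ∣₀ a ∣) where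
    open Projection a w aw
    light : + 2 * (q * ∣ B ∣₁ a ∣) < card r
    light = heavy-arith (card r) (∣ B ∣) (∣ B ∣₀ a ∣) (∣ B ∣₁ a ∣) q (∣∣-split B a) dense′ heavy
    -- The projected columns span a geometry of `E` inside the hyperplane. Each of its cosets off
    -- the hyperplane must meet `B`, or it would extend to a forbidden geometry; but the fewer than
    -- N/(2q) points of `B` there have too few translates to cover N/2 points.
    restricted-free : ∀ (M : Matrix r (2 ℕ.+ k)) → ¬ PGIn (E ∘ π) M
    restricted-free M pg = <⇒≱ light (subst₂ _≤_ (2∣hyperplane∣) refl
        (*-monoˡ-≤-nonNeg (+ 2) (≤-trans (∑-mono (λ v → ind-mono (covered v))) (∣hull∣₁ B M′ a a⊥))))
      where
      M′ : Matrix r (2 ℕ.+ k)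
      M′ = Vec.map π M
      pg′ : PGIn E M′
      pg′ b b≢0 = trans (cong E (π-apply M b)) (pg b b≢0)
      a⊥ : ∀ y → a · apply M′ y ≡ false
      a⊥ y = trans (cong (a ·_) (π-apply M y)) (π-⊥ (apply M y))
      covered : ∀ v → a · v ≡ true → (hull B M′ ∣₁ a) v ≡ true
      covered v av with hull B M′ v in e
      ... | true  = av
      ... | false = ⊥-elim (free (v ∷ M′) (PGIn-∷ E M′ pg′ e))
      2∣hyperplane∣ : + 2 * ∣ (a ·_) ∣ ≡ card r
      2∣hyperplane∣ = trans (double ∣ (a ·_) ∣) (∣hyperplane∣ a w aw)
        where
        double : ∀ x → + 2 * x ≡ x + x
        double = solve-∀
    restricted-dense : q * ∣ not ∘ (E ∘ π) ∣ < + 3 * card r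
    restricted-dense = subst (λ b → q * b < + 3 * card r) (sym (∣∘π∣ B))
      (restriction-arith (card r) (∣ B ∣) (∣ B ∣₀ a ∣) (∣ B ∣₁ a ∣) q (0≤card (2 ℕ.+ k)) (∣∣-≥0 (B ∣₁ a)) (∣∣-split B a) dense′)
    extend : (∃ λ (Φ : Vec (F₂^ r) (2 ℕ.+ k)) → Separates Φ (E ∘ π)) → ∃ λ Φ → Separates Φ E
    -- Where `a` vanishes `π` is the identity, so the functionals found for `E ∘ π` handle the rest
    -- of `E`.
    extend (Φ , sep) = a ∷ Φ , λ v Ev e →
      sep v (trans (cong E (π-fix v (cong Vec.head e))) Ev) (cong Vec.tail e)
    recurse : ∃ λ Φ → Separates Φ E
    recurse = extend (dense⇒separated k (E ∘ π) (trans (cong E π-𝟎) E𝟎) restricted-free restricted-dense)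
  from : HeavyHyperplane B k → ∃ λ Φ → Separates Φ E
  from (a , w , aw , heavy) = recurse a w aw heavy

-- From functionals to critical numbers

_≟ᵛ_ : (u v : F₂^ r) → Dec (u ≡ v)
_≟ᵛ_ = ≡-dec Data.Bool._≟_

-- A transpose: functionals are rows, whereas `Matrix` stores columns.
toMatrix : Vec (F₂^ r) n → Matrix n r
toMatrix {zero}  Φ = []
toMatrix {suc r} Φ = Vec.map Vec.head Φ ∷ toMatrix (Vec.map Vec.tail Φ)

apply-toMatrix : (Φ : Vec (F₂^ r) n) (v : F₂^ r) → apply (toMatrix Φ) v ≡ values Φ v
apply-toMatrix {zero} Φ [] = constant Φ
  where
  constant : ∀ {n} (Φ : Vec (F₂^ 0) n) → 𝟎 ≡ values Φ []
  constant []       = refl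
  constant ([] ∷ Φ) = cong (false ∷_) (constant Φ)
apply-toMatrix {suc r} Φ (false ∷ v) = trans (apply-toMatrix (Vec.map Vec.tail Φ) v) (tails Φ)
  where
  tails : ∀ {n} (Φ : Vec (F₂^ (suc r)) n) → values (Vec.map Vec.tail Φ) v ≡ values Φ (false ∷ v)
  tails []                = refl
  tails ((false ∷ φ) ∷ Φ) = cong (φ · v ∷_) (tails Φ)
  tails ((true ∷ φ) ∷ Φ)  = cong (φ · v ∷_) (tails Φ)
apply-toMatrix {suc r} Φ (true ∷ v) =
  trans (cong (Vec.map Vec.head Φ ⊕_) (apply-toMatrix (Vec.map Vec.tail Φ) v)) (heads Φ)
  where
  heads : ∀ {n} (Φ : Vec (F₂^ (suc r)) n) →
    Vec.map Vec.head Φ ⊕ values (Vec.map Vec.tail Φ) v ≡ values Φ (true ∷ v)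
  heads []                = refl
  heads ((false ∷ φ) ∷ Φ) = cong (φ · v ∷_) (heads Φ)
  heads ((true ∷ φ) ∷ Φ)  = cong (not (φ · v) ∷_) (heads Φ)

values-⊕ : (Φ : Vec (F₂^ r) n) (u v : F₂^ r) → values Φ (u ⊕ v) ≡ values Φ u ⊕ values Φ v
values-⊕ []      u v = refl
values-⊕ (φ ∷ Φ) u v = cong₂ _∷_ (·-⊕ʳ φ u v) (values-⊕ Φ u v)

-- Greedy choice: a functional vanishing on the common kernel of those kept is dropped. Otherwise
-- some kernel vector `u` with `φ · u ≡ true` corrects the new coordinate without disturbing the
-- others, which keeps the map onto.
independent-subfamily : (Φ : Vec (F₂^ r) n) → ∃ λ j → j ℕ.≤ n × ∃ λ (Ψ : Vec (F₂^ r) j) →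
  (∀ y → ∃ λ x → values Ψ x ≡ y) × (∀ v → values Ψ v ≡ 𝟎 → values Φ v ≡ 𝟎)
independent-subfamily [] = 0 , z≤n , [] , (λ { [] → 𝟎 , refl }) , λ v e → e
independent-subfamily (φ ∷ Φ) with independent-subfamily Φ
... | j , j≤n , Ψ , onto , kernel with search (λ v → φ · v ∧ does (values Ψ v ≟ᵛ 𝟎))
...   | inj₂ none = j , ℕ.m≤n⇒m≤1+n j≤n , Ψ , onto , λ v e → cong₂ _∷_ (vanish v e (none v)) (kernel v e)
  where
  vanish : ∀ v → values Ψ v ≡ 𝟎 → φ · v ∧ does (values Ψ v ≟ᵛ 𝟎) ≡ false → φ · v ≡ false
  vanish v e p with φ · v | values Ψ v ≟ᵛ 𝟎
  ... | false | _      = refl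
  ... | true  | no ¬e  = ⊥-elim (¬e e)
...   | inj₁ (u , found) = suc j , s≤s j≤n , φ ∷ Ψ , onto′ , λ v e → cong₂ _∷_ (cong Vec.head e) (kernel v (cong Vec.tail e))
  where
  φu : φ · u ≡ true
  φu = proj₁ (∧-true {φ · u} found)
  decided : ∀ v → does (values Ψ v ≟ᵛ 𝟎) ≡ true → values Ψ v ≡ 𝟎
  decided v p with values Ψ v ≟ᵛ 𝟎
  ... | yes e = e
  Ψu : values Ψ u ≡ 𝟎
  Ψu = decided u (proj₂ (∧-true {φ · u} found))
  onto′ : ∀ y → ∃ λ x → values (φ ∷ Ψ) x ≡ y
  onto′ (b ∷ y) with onto y
  ... | x , Ψx with φ · x Data.Bool.≟ b
  ...   | yes φx = x , cong₂ _∷_ φx Ψx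
  ...   | no φx≢b = x ⊕ u , cong₂ _∷_
            (trans (·-⊕ʳ φ x u) (trans (cong ((φ · x) xor_) φu) (flip (φ · x) b φx≢b)))
            (trans (values-⊕ Ψ x u) (trans (cong (values Ψ x ⊕_) Ψu) (trans (⊕-identityʳ (values Ψ x)) Ψx)))
    where
    flip : ∀ c b → c ≢ b → c xor true ≡ b
    flip false false c≢b = ⊥-elim (c≢b refl)
    flip false true  _   = refl
    flip true  false _   = refl
    flip true  true  c≢b = ⊥-elim (c≢b refl)

T⇒≡ : ∀ {b} → T b → b ≡ true
T⇒≡ {true} _ = refl

≡⇒T : ∀ {b} → b ≡ true → T b
≡⇒T refl = _

HasDisjointCodim-≤ : (M : Matroid) (Φ : Vec (F₂^ (rank M)) n) → Separates Φ (E M) →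
  ∃ λ j → j ℕ.≤ n × HasDisjointCodim M j
HasDisjointCodim-≤ M Φ sep with independent-subfamily Φ
... | j , j≤n , Ψ , onto , kernel = j , j≤n , toMatrix Ψ ,
  (λ y → let x , Ψx = onto y in x , trans (apply-toMatrix Ψ x) Ψx) ,
  λ v Ev e → sep v (T⇒≡ Ev) (kernel v (trans (sym (apply-toMatrix Ψ v)) e))

-- Injectivity holds because a nonzero kernel vector would be sent into `E M`, which omits the
-- origin.
PGIn⇒Contains : (M : Matroid) (t : ℕ) (ι : Matrix (rank M) t) → PGIn (E M) ι → Contains M (PG t)
PGIn⇒Contains M t ι pg = ι , injective , λ v v≢0 → ≡⇒T (pg v (nonzero (PG t) v v≢0))
  where
  injective : ∀ {x y} → apply ι x ≡ apply ι y → x ≡ y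
  injective {x} {y} e with (x ⊕ y) ≟ᵛ 𝟎
  ... | yes xy≡0 = ⊕≡𝟎⇒≡ x y xy≡0
  ... | no xy≢0  = ⊥-elim (nonzero M (apply ι (x ⊕ y)) (≡⇒T (pg (x ⊕ y) xy≢0))
          (trans (apply-⊕ ι x y) (trans (cong (_⊕ apply ι y) e) (⊕-self (apply ι y)))))

-- The 2^m fibres partition the domain, and each is empty or a translate of the kernel.
kernel-large : (A : Matrix m n) → card n ≤ card m * ∣ (λ v → does (apply A v ≟ᵛ 𝟎)) ∣
kernel-large {m} {n} A = subst₂ _≤_ fibres (trans (∑-const {m} ∣ K ∣) (*-comm ∣ K ∣ (card m)))
  (∑-mono fibre)
  where
  K : F₂^ n → Bool
  K v = does (apply A v ≟ᵛ 𝟎)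
  over : F₂^ m → F₂^ n → Bool
  over y v = does (apply A v ≟ᵛ y)
  decided : ∀ y v → over y v ≡ true → apply A v ≡ y
  decided y v p with apply A v ≟ᵛ y
  ... | yes e = e
  to-kernel : ∀ y u v → apply A u ≡ y → over y v ≡ true → K (v ⊕ u) ≡ true
  to-kernel y u v Au p with apply A (v ⊕ u) ≟ᵛ 𝟎
  ... | yes _ = refl
  ... | no ¬e = ⊥-elim (¬e (trans (apply-⊕ A v u) (trans (cong₂ _⊕_ (decided y v p) Au) (⊕-self y))))
  fibre : ∀ y → ∣ over y ∣ ≤ ∣ K ∣
  fibre y with search (over y)
  ... | inj₂ none    = subst (_≤ ∣ K ∣) (sym (∣∣-false {P = over y} none)) (∣∣-≥0 K)
  ... | inj₁ (u , p) = subst (∣ over y ∣ ≤_) (∑-shift (ind ∘ K) u)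
          (∑-mono λ v → ind-mono (to-kernel y u v (decided y u p)))
  over-self : ∀ v → over (apply A v) v ≡ true
  over-self v with apply A v ≟ᵛ apply A v
  ... | yes _ = refl
  ... | no ¬e = ⊥-elim (¬e refl)
  one : ∀ v → ∑ (λ y → ind (over y v)) ≡ 1ℤ
  one v = ≤-antisym (∣∣-unique (λ y → over y v) (λ y z p q → trans (sym (decided y v p)) (decided z v q)))
    (subst₂ _≤_ (cong ind (trans (cong (λ y → over y v) (⊕-identityˡ (apply A v))) (over-self v))) (∑-shift (λ y → ind (over y v)) (apply A v))
      (∑-≥-𝟎 (λ y → ind (over (y ⊕ apply A v) v)) (λ y _ → ind-≥0 (over (y ⊕ apply A v) v))))
  fibres : ∑ (λ y → ∣ over y ∣) ≡ card n
  fibres = trans (∑-swap (λ y v → ind (over y v))) (trans (∑-cong one) (trans (∑-const {n} 1ℤ) (*-identityˡ (card n))))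

-- For j ≤ t - 2 a disjoint kernel has at least 4N/2^t points, all in the complement of `E M`, which
-- has fewer than 3N/2^t.
codim-lower-bound : (M : Matroid) (t j : ℕ) → 2 ℕ.+ j ℕ.≤ t →
  card t * ∣ not ∘ E M ∣ < + 3 * card (rank M) → ¬ HasDisjointCodim M j
codim-lower-bound M t j 2+j≤t dense (A , _ , disjoint) = contradict (card t) (card j) (card (rank M)) ∣ B ∣
  (∣∣-≥0 B) (subst (_≤ card t) (card-quadruple j) (+≤+ (ℕ.^-monoʳ-≤ 2 2+j≤t))) dense
  (≤-trans (kernel-large A) (*-monoˡ-≤-nonNeg (card j) (∑-mono λ v → ind-mono (K⊆B v)))) (0≤card (rank M))
  where
  B = not ∘ E M
  K⊆B : ∀ v → does (apply A v ≟ᵛ 𝟎) ≡ true → B v ≡ true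
  K⊆B v p with apply A v ≟ᵛ 𝟎 | E M v in Ev
  ... | _     | false = refl
  ... | yes e | true  = ⊥-elim (disjoint v (≡⇒T Ev) e)
  contradict : ∀ p q N b → 0ℤ ≤ b → + 4 * q ≤ p → p * b < + 3 * N → N ≤ q * b → 0ℤ ≤ N → ⊥
  contradict p q N b 0≤b 4q≤p lt ge 0≤N = negative-absurd
    (+-nonNeg (+-nonNeg (+-nonNeg (slack< lt) (*-nonNeg (slack 4q≤p) 0≤b)) (*-nonNeg {+ 4} (+≤+ z≤n) (slack ge))) 0≤N)
    (identity p q N b)
    where
    identity : ∀ p q N b → (+ 3 * N - p * b - 1ℤ) + (p - + 4 * q) * b + + 4 * (q * b - N) + N ≡ - 1ℤ
    identity = solve-∀

-- Decidability and the conclusion.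

∀? : {P : F₂^ n → Set} → (∀ v → Dec (P v)) → Dec (∀ v → P v)
∀? {zero}  P? = map′ (λ { p [] → p }) (λ p → p []) (P? [])
∀? {suc n} P? = map′ (λ { (p , q) (false ∷ v) → p v ; (p , q) (true ∷ v) → q v })
  (λ p → p ∘ (false ∷_) , p ∘ (true ∷_)) (∀? (P? ∘ (false ∷_)) ×-dec ∀? (P? ∘ (true ∷_)))

∃? : {P : F₂^ n → Set} → (∀ v → Dec (P v)) → Dec (∃ P)
∃? {zero}  P? = map′ ([] ,_) (λ { ([] , p) → p }) (P? [])
∃? {suc n} P? = map′
  (λ { (inj₁ (v , p)) → false ∷ v , p ; (inj₂ (v , p)) → true ∷ v , p })
  (λ { (false ∷ v , p) → inj₁ (v , p) ; (true ∷ v , p) → inj₂ (v , p) })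
  (∃? (P? ∘ (false ∷_)) ⊎-dec ∃? (P? ∘ (true ∷_)))

∃-matrix? : {P : Matrix m n → Set} → (∀ A → Dec (P A)) → Dec (∃ P)
∃-matrix? {n = zero}  P? = map′ ([] ,_) (λ { ([] , p) → p }) (P? [])
∃-matrix? {n = suc n} P? = map′ (λ (c , A , p) → c ∷ A , p) (λ { (c ∷ A , p) → c , A , p })
  (∃? λ c → ∃-matrix? λ A → P? (c ∷ A))

-- Deciding codimension t - 1 by finite search is what selects one of the two alternatives
-- constructively.
HasDisjointCodim? : (M : Matroid) (k : ℕ) → Dec (HasDisjointCodim M k)
HasDisjointCodim? M k = ∃-matrix? λ A →
  (∀? λ y → ∃? λ x → apply A x ≟ᵛ y) ×-dec (∀? λ v → T? (E M v) →-dec ¬? (apply A v ≟ᵛ 𝟎))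

theorem1p4 : (t : ℕ) → 2 ℕ.≤ t → (M : Matroid) → ¬ Contains M (PG t)
    → (2 ℕ.^ t ℕ.∸ 3) ℕ.* 2 ℕ.^ rank M ℕ.< 2 ℕ.^ t ℕ.* size M
    → CriticalNumberIs M (t ℕ.∸ 1) ⊎ CriticalNumberIs M t
theorem1p4 (suc (suc k)) (s≤s (s≤s z≤n)) M free large =
  from (HasDisjointCodim-≤ M (proj₁ separated) (proj₂ separated)) (HasDisjointCodim? M (suc k))
  where
  t = 2 ℕ.+ k
  N = card (rank M)
  e = ∣ E M ∣
  E𝟎 : E M 𝟎 ≡ false
  E𝟎 with E M 𝟎 in eq
  ... | false = refl
  ... | true  = ⊥-elim (nonzero M 𝟎 (≡⇒T eq) refl)
  -- Truncated and integer subtraction agree here because 2^t is at least 4.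
  large′ : (card t - + 3) * N < card t * e
  large′ = subst₂ _<_
    (trans (pos-* (2 ℕ.^ t ℕ.∸ 3) (2 ℕ.^ rank M)) (cong (_* N) (trans (sym (⊖-≥ 3≤2^t)) (sym (m-n≡m⊖n (2 ℕ.^ t) 3)))))
    (trans (pos-* (2 ℕ.^ t) (size M)) (cong (card t *_) (count≡∣∣ (E M))))
    (Data.Integer.+<+ large)
    where
    3≤2^t : 3 ℕ.≤ 2 ℕ.^ t
    3≤2^t = ℕ.≤-trans (ℕ.n≤1+n 3) (ℕ.^-monoʳ-≤ 2 {2} {t} (s≤s (s≤s z≤n)))
  dense : card t * ∣ not ∘ E M ∣ < + 3 * N
  dense = subst (λ b → card t * b < + 3 * N) (sym (∣∣-not (E M))) (arith (card t) N e large′)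
    where
    arith : ∀ p N e → (p - + 3) * N < p * e → p * (N - e) < + 3 * N
    arith p N e lt = ≰⇒> λ le → negative-absurd (+-nonNeg (slack< lt) (slack le)) (identity p N e)
      where
      identity : ∀ p N e → (p * e - (p - + 3) * N - 1ℤ) + (p * (N - e) - + 3 * N) ≡ - 1ℤ
      identity = solve-∀
  separated : ∃ λ (Φ : Vec (F₂^ (rank M)) t) → Separates Φ (E M)
  separated = dense⇒separated k (E M) E𝟎 (λ ι pg → free (PGIn⇒Contains M t ι pg)) dense
  below : ∀ j → j ℕ.< suc k → ¬ HasDisjointCodim M j
  below j j<k+1 = codim-lower-bound M t j (s≤s j<k+1) dense
  from : (∃ λ j → j ℕ.≤ t × HasDisjointCodim M j) → Dec (HasDisjointCodim M (suc k)) →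
    CriticalNumberIs M (suc k) ⊎ CriticalNumberIs M t
  from _ (yes h) = inj₁ (h , below)
  -- With t - 1 excluded as well, no codimension below t is possible, so the one obtained from the
  -- functionals is t itself.
  from (j , j≤t , h) (no ¬h) = inj₂ (subst (HasDisjointCodim M) j≡t h , minimal)
    where
    minimal : ∀ i → i ℕ.< t → ¬ HasDisjointCodim M i
    minimal i i<t h with ℕ.m≤n⇒m<n∨m≡n (ℕ.≤-pred i<t)
    ... | inj₁ i<k+1 = below i i<k+1 h
    ... | inj₂ refl  = ¬h h
    j≡t : j ≡ t
    j≡t with ℕ.m≤n⇒m<n∨m≡n j≤t
    ... | inj₁ j<t = ⊥-elim (minimal j j<t h)
    ... | inj₂ e   = e
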